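{- Let $d\ge 1$ and $k\ge 1$ be fixed. For every fixed integer $j\ge 2$, $$F(n,j,k,d)=\Theta(n^{d-1})\qquad (n\to\infty).$$
   Context: A $d$-dimensional $n_1\times\cdots\times n_d$ zero-one matrix is an array $A=(a_{i_1,\ldots,i_d})$, $1\le i_\ell\le n_\ell$, with entries in $\{0,1\}$. A submatrix is obtained by selecting, for each $\ell$, a set of values of the $\ell$-th coordinate (keeping the order). $A$ contains a $d$-dimensional zero-one matrix $B$ if some submatrix of $A$ can be transformed into $B$ by changing any number of ones to zeros; otherwise $A$ avoids $B$. $f(n,B,d)$ denotes the maximum number of ones in a $d$-dimensional $n\times\cdots\times n$ zero-one matrix that avoids $B$. An $\ell$-cross section is the set of all entries having a fixed value of the $\ell$-th coordinate. A $d$-dimensional $k\times\cdots\times k$ zero-one matrix is a permutation matrix if each of its $\ell$-cross sections contains exactly one nonzero entry, for every $\ell=1,\ldots,d$. $R^{k_1,\ldots,k_d}$ is the $k_1\times\cdots\times k_d$ matrix of all ones, and the Kronecker product $M\otimes N$ is obtained by replacing each $1$-entry of $M$ by a copy of $N$ and each $0$-entry of $M$ by a zero matrix of the same size as $N$. For a permutation matrix $P$, the matrix $P\otimes R^{k_1,\ldots,k_d}$ is called a $j$-tuple permutation matrix generated by $P$ if one of $k_1,\ldots,k_d$ equals $j$ and the rest equal $1$. Define $F(n,j,k,d)=\max_M f(n,M,d)$, where $M$ ranges over all $d$-dimensional $j$-tuple permutation matrices generated by $d$-dimensional $k\times\cdots\times k$ permutation matrices. Implied constants may depend on $d,j,k$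 but not on $n$. -}

module Defs where

open import Data.Bool.Base using (Bool; true; false; T; _∧_)
open import Data.Bool.Properties using (T?)
open import Data.Fin.Base as Fin using (Fin; zero; suc; quotient; remainder; finToFun; funToFin)
import Data.Fin.Properties as Fin
open import Data.List.Base as List using (List; []; _∷_; length; filter; filterᵇ; map; allFin; cartesianProductWith)
open import Data.List.Extrema.Nat using (max; xs≤max; argmax-sel)
open import Data.List.Membership.Propositional using (_∈_; lose)
open import Data.List.Membership.Propositional.Properties
  using (∈-map⁺; ∈-map⁻; ∈-filter⁺; ∈-filter⁻; ∈-allFin; ∈-cartesianProductWith⁺; ∈-cartesianProductWith⁻)
open import Data.List.Properties using (filter-≐)
import Data.List.Relation.Unary.All as ListAll
open import Data.List.Relation.Unary.Any using (here; there)
open import Data.Nat.Base using (ℕ; zero; suc; _*_; _^_; _≤_)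
open import Data.Nat.Properties using (n≤0⇒n≡0; ≤-trans; ≤-reflexive)
open import Data.Product.Base using (Σ; ∃; ∃-syntax; _×_; _,_; proj₁; proj₂)
open import Data.Product using (∃!)
open import Data.Sum.Base using (inj₁; inj₂)
open import Data.Vec.Base as Vec using (Vec; []; _∷_; replicate; zipWith; _[_]≔_)
import Data.Vec.Functional as Vector
open import Data.Vec.Relation.Binary.Pointwise.Inductive using (Pointwise; []; _∷_)
open import Data.Vec.Relation.Unary.All using (All; []; _∷_)
open import Function.Base using (_∘_; id)
open import Relation.Binary.Core using (_Preserves_⟶_)
open import Relation.Binary.PropositionalEquality
  using (_≡_; refl; sym; trans; cong; cong₂; subst; _≗_)
open import Relation.Nullary using (¬_; Dec; yes; no)
open import Relation.Nullary.Decidable using (map′; _×-dec_; _→-dec_; ¬?)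

private variable
  d : ℕ
  ns : Vec ℕ d

Index : Vec ℕ d → Set
Index ns = All Fin ns

coord : Index ns → (ℓ : Fin d) → Fin (Vec.lookup ns ℓ)
coord (i ∷ is) zero    = i
coord (i ∷ is) (suc ℓ) = coord is ℓ

Matrix : Vec ℕ d → Set
Matrix ns = Index ns → Bool

indices : (ns : Vec ℕ d) → List (Index ns)
indices []       = [] ∷ []
indices (n ∷ ns) = cartesianProductWith _∷_ (allFin n) (indices ns)

ones : Matrix ns → ℕ
ones {ns = ns} A = length (filterᵇ A (indices ns))

-- Choosing m of the n values of a coordinate is the same as giving the
-- increasing enumeration of the chosen values.

Selection : ℕ → ℕ → Set
Selection m n = Σ (Fin m → Fin n) λ σ → σ Preserves Fin._<_ ⟶ Fin._<_

select : {ms ns : Vec ℕ d} → Pointwise Selection ms ns → Index ms → Index ns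
select []             []       = []
select ((σ , _) ∷ σs) (i ∷ is) = σ i ∷ select σs is

submatrix : {ms ns : Vec ℕ d} → Matrix ns → Pointwise Selection ms ns → Matrix ms
submatrix A σs = A ∘ select σs

Contains : {ms ns : Vec ℕ d} → Matrix ns → Matrix ms → Set
Contains {ms = ms} {ns = ns} A B =
  Σ (Pointwise Selection ms ns) λ σs → ∀ i → T (B i) → T (submatrix A σs i)

Avoids : {ms ns : Vec ℕ d} → Matrix ns → Matrix ms → Set
Avoids A B = ¬ Contains A B

IsPermutation : Matrix ns → Set
IsPermutation {ns = ns} A =
  ∀ ℓ (v : Fin (Vec.lookup ns ℓ)) → ∃! _≡_ λ i → coord i ℓ ≡ v × T (A i)

-- Position i of the product lies in the block with index `quotients i`,
-- at position `remainders i` within that block.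

quotients : (ms ns : Vec ℕ d) → Index (zipWith _*_ ms ns) → Index ms
quotients []       []       []       = []
quotients (m ∷ ms) (n ∷ ns) (i ∷ is) = quotient {m} n i ∷ quotients ms ns is

remainders : (ms ns : Vec ℕ d) → Index (zipWith _*_ ms ns) → Index ns
remainders []       []       []       = []
remainders (m ∷ ms) (n ∷ ns) (i ∷ is) = remainder {m} n i ∷ remainders ms ns is

infixl 7 _⊗_

_⊗_ : {ms ns : Vec ℕ d} → Matrix ms → Matrix ns → Matrix (zipWith _*_ ms ns)
_⊗_ {ms = ms} {ns = ns} M N i = M (quotients ms ns i) ∧ N (remainders ms ns i)

R : (ns : Vec ℕ d) → Matrix ns
R ns _ = true

tupleShape : ℕ → Fin d → Vec ℕ d
tupleShape {d} j ℓ = replicate d 1 [ ℓ ]≔ j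

tuple : (j : ℕ) (ℓ : Fin d) → Matrix ns → Matrix (zipWith _*_ ns (tupleShape j ℓ))
tuple j ℓ P = P ⊗ R (tupleShape j ℓ)

private
  ∈-indices : (i : Index ns) → i ∈ indices ns
  ∈-indices []       = here refl
  ∈-indices (i ∷ is) = ∈-cartesianProductWith⁺ _∷_ (∈-allFin i) (∈-indices is)

  allIndices? : {Q : Index ns → Set} → (∀ i → Dec (Q i)) → Dec (∀ i → Q i)
  allIndices? {ns = ns} Q? =
    map′ (λ qs i → ListAll.lookup qs (∈-indices i)) (λ q → ListAll.tabulate λ {i} _ → q i)
         (ListAll.all? Q? (indices ns))

  anyIndex? : {Q : Index ns → Set} → (∀ i → Dec (Q i)) → Dec (∃ Q)
  anyIndex? {ns = ns} Q? =
    map′ (λ a → _ , proj₂ (proj₂ (find a))) (λ { (i , q) → lose (∈-indices i) q })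
         (any? Q? (indices ns))
    where
    open import Data.List.Relation.Unary.Any using (any?)
    open import Data.List.Membership.Propositional using (find)

  _≟ⁱ_ : (i j : Index ns) → Dec (i ≡ j)
  []       ≟ⁱ []       = yes refl
  (i ∷ is) ≟ⁱ (j ∷ js) =
    map′ (λ { (refl , refl) → refl }) (λ { refl → refl , refl }) ((i Fin.≟ j) ×-dec (is ≟ⁱ js))

  increasing? : ∀ {m n} (σ : Fin m → Fin n) → Dec (σ Preserves Fin._<_ ⟶ Fin._<_)
  increasing? σ =
    map′ (λ p {i} {j} → p i j) (λ p i j → p {i} {j})
         (Fin.all? λ i → Fin.all? λ j → (i Fin.<? j) →-dec (σ i Fin.<? σ j))

  ∃select? : ∀ {d} (ms ns : Vec ℕ d) (Q : (Index ms → Index ns) → Set) →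
             (∀ {g h} → g ≗ h → Q g → Q h) → (∀ g → Dec (Q g)) →
             Dec (Σ (Pointwise Selection ms ns) (Q ∘ select))
  ∃select? []       []       Q resp Q? =
    map′ (λ q → [] , resp (λ { [] → refl }) q)
         (λ { ([] , q) → resp (λ { [] → refl }) q })
         (Q? id)
  ∃select? (m ∷ ms) (n ∷ ns) Q resp Q? =
    map′ to from (Fin.any? {n = n ^ m} λ c → increasing? (finToFun {n} {m} c) ×-dec rest? (finToFun c))
    where
    _⊕_ : (Fin m → Fin n) → (Index ms → Index ns) → Index (m ∷ ms) → Index (n ∷ ns)
    (σ ⊕ g) (i ∷ is) = σ i ∷ g is

    Rest : (Fin m → Fin n) → Set
    Rest σ = Σ (Pointwise Selection ms ns) λ σs → Q (σ ⊕ select σs)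

    rest? : ∀ σ → Dec (Rest σ)
    rest? σ = ∃select? ms ns (λ g → Q (σ ⊕ g))
      (λ g≗h → resp λ { (i ∷ is) → cong (σ i ∷_) (g≗h is) }) (λ g → Q? (σ ⊕ g))

    to : _
    to (c , inc , σs , q) = ((finToFun c , inc) ∷ σs) , resp (λ { (i ∷ is) → refl }) q

    from : _
    from (((σ , inc) ∷ σs) , q) =
      funToFin σ ,
      (λ {i} {j} i<j → subst id (sym (cong₂ Fin._<_ (σ≗ i) (σ≗ j))) (inc i<j)) ,
      σs , resp (λ { (i ∷ is) → cong (_∷ _) (sym (σ≗ i)) }) q
      where σ≗ = Fin.finToFun-funToFin σ

contains? : {ms ns : Vec ℕ d} → (A : Matrix ns) (B : Matrix ms) → Dec (Contains A B)
contains? {ms = ms} {ns = ns} A B = ∃select? ms ns (λ g → ∀ i → T (B i) → T (A (g i)))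
  (λ g≗h q i b → subst (T ∘ A) (g≗h i) (q i b))
  (λ g → allIndices? λ i → T? (B i) →-dec T? (A (g i)))

avoids? : {ms ns : Vec ℕ d} → (B : Matrix ms) (A : Matrix ns) → Dec (Avoids A B)
avoids? B A = ¬? (contains? A B)

isPermutation? : (A : Matrix ns) → Dec (IsPermutation A)
isPermutation? A = Fin.all? λ ℓ → Fin.all? λ v → unique? λ i → (coord i ℓ Fin.≟ v) ×-dec T? (A i)
  where
  unique? : {Q : Index ns → Set} → (∀ i → Dec (Q i)) → Dec (∃! _≡_ Q)
  unique? Q? = anyIndex? λ i → Q? i ×-dec
    map′ (λ u {j} → u j) (λ u j → u {j}) (allIndices? λ j → Q? j →-dec (i ≟ⁱ j))

vectors : {X : Set} (n : ℕ) → List X → List (Fin n → X)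
vectors zero    xs = Vector.[] ∷ []
vectors (suc n) xs = cartesianProductWith Vector._∷_ xs (vectors n xs)

-- Every matrix of the given shape occurs in this list up to pointwise
-- equality; see `matrices-complete`.

matrices : (ns : Vec ℕ d) → List (Matrix ns)
matrices []       = (λ _ → true) ∷ (λ _ → false) ∷ []
matrices (n ∷ ns) = map (λ { A (i ∷ is) → A i is }) (vectors n (matrices ns))

-- `max 0` is 0 on the empty list; `f-isMaximum` and `F-isMaximum` show that
-- these are genuine maxima whenever there is anything to maximise over.

f : {ms : Vec ℕ d} → ℕ → Matrix ms → ℕ
f {d} n B = max 0 (map ones (filter (avoids? B) (matrices (replicate d n))))

F : (n j k d : ℕ) → ℕ
F n j k d = max 0 (cartesianProductWith (λ ℓ P → f n (tuple j ℓ P))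
                     (allFin d) (filter isPermutation? (matrices (replicate d k))))

IsMaximum : (ℕ → Set) → ℕ → Set
IsMaximum S m = S m × (∀ x → S x → x ≤ m)

NumberOfOnesAvoiding : {ms : Vec ℕ d} → ℕ → Matrix ms → ℕ → Set
NumberOfOnesAvoiding {d} n B w =
  Σ (Matrix (replicate d n)) λ A → Avoids A B × ones A ≡ w

TupleValue : (n j k d : ℕ) → ℕ → Set
TupleValue n j k d w =
  Σ (Fin d) λ ℓ → Σ (Matrix (replicate d k)) λ P → IsPermutation P × f n (tuple j ℓ P) ≡ w

private
  vectors-complete : {X : Set} (_≈_ : X → X → Set) (xs : List X) →
                     (∀ x → ∃[ y ] y ∈ xs × x ≈ y) → ∀ n (g : Fin n → X) →
                     ∃[ h ] h ∈ vectors n xs × (∀ i → g i ≈ h i)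
  vectors-complete _≈_ xs c zero    g = Vector.[] , here refl , λ ()
  vectors-complete _≈_ xs c (suc n) g
    with y , y∈ , x≈y ← c (g zero)
    with h , h∈ , g≈h ← vectors-complete _≈_ xs c n (g ∘ suc)
    = y Vector.∷ h , ∈-cartesianProductWith⁺ Vector._∷_ y∈ h∈ ,
      λ { zero → x≈y ; (suc i) → g≈h i }

matrices-complete : (A : Matrix ns) → ∃[ A′ ] A′ ∈ matrices ns × A ≗ A′
matrices-complete {ns = []} A with A [] in eq
... | true  = _ , here refl , λ { [] → eq }
... | false = _ , there (here refl) , λ { [] → eq }
matrices-complete {ns = n ∷ ns} A
  with h , h∈ , A≗h ← vectors-complete _≗_ (matrices ns) matrices-complete n (λ i is → A (i ∷ is))
  = _ , ∈-map⁺ _ h∈ , λ { (i ∷ is) → A≗h i is }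

private
  ones-cong : {A A′ : Matrix ns} → A ≗ A′ → ones A ≡ ones A′
  ones-cong {ns = ns} {A} {A′} eq = cong length (filter-≐ (T? ∘ A) (T? ∘ A′)
    ((λ {i} → subst T (eq i)) , (λ {i} → subst T (sym (eq i)))) (indices ns))

  Contains-resp : {ms ns : Vec ℕ d} → {A A′ : Matrix ns} {B B′ : Matrix ms} →
                  A ≗ A′ → B ≗ B′ → Contains A B → Contains A′ B′
  Contains-resp A≗ B≗ (σs , c) =
    σs , λ i b → subst T (A≗ (select σs i)) (c i (subst T (sym (B≗ i)) b))

  IsPermutation-resp : {A A′ : Matrix ns} → A ≗ A′ → IsPermutation A → IsPermutation A′
  IsPermutation-resp eq p ℓ v with i , (c , a) , u ← p ℓ v
    = i , (c , subst T (eq i) a) , λ { {j} (c′ , a′) → u (c′ , subst T (sym (eq j)) a′) }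

  f-cong : {ms : Vec ℕ d} (n : ℕ) {B B′ : Matrix ms} → B ≗ B′ → f n B ≡ f n B′
  f-cong {d} n {B} {B′} eq = cong (max 0 ∘ map ones) (filter-≐ (avoids? B) (avoids? B′)
    ( (λ {A} av c → av (Contains-resp {A = A} (λ _ → refl) (sym ∘ eq) c))
    , (λ {A} av c → av (Contains-resp {A = A} (λ _ → refl) eq c))) (matrices (replicate d n)))

  max-isMaximum : (S : ℕ → Set) (xs : List ℕ) → (∀ x → S x → x ∈ xs) → (∀ x → x ∈ xs → S x) →
                  ∃ S → IsMaximum S (max 0 xs)
  max-isMaximum S xs S⊆ ⊆S (w , s) = attained , bound
    where
    bound : ∀ x → S x → x ≤ max 0 xs
    bound x p = ListAll.lookup (xs≤max 0 xs) (S⊆ x p)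

    attained : S (max 0 xs)
    attained with argmax-sel id 0 xs
    ... | inj₂ m∈  = ⊆S _ m∈
    ... | inj₁ m≡0 = subst S (trans (n≤0⇒n≡0 (≤-trans (bound w s) (≤-reflexive m≡0))) (sym m≡0)) s

f-isMaximum : {ms : Vec ℕ d} (n : ℕ) (B : Matrix ms) →
              ∃ (NumberOfOnesAvoiding n B) → IsMaximum (NumberOfOnesAvoiding n B) (f n B)
f-isMaximum {d} n B = max-isMaximum _ values to from
  where
  avoiding = filter (avoids? B) (matrices (replicate d n))
  values = map ones avoiding

  to : ∀ w → NumberOfOnesAvoiding n B w → w ∈ values
  to _ (A , av , refl) with A′ , A′∈ , eq ← matrices-complete A =
    subst (_∈ values) (sym (ones-cong eq))
      (∈-map⁺ ones (∈-filter⁺ (avoids? B) A′∈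
        (λ c → av (Contains-resp (sym ∘ eq) (λ _ → refl) c))))

  from : ∀ w → w ∈ values → NumberOfOnesAvoiding n B w
  from w w∈ with A , A∈ , w≡ ← ∈-map⁻ ones {xs = avoiding} w∈
    = A , proj₂ (∈-filter⁻ (avoids? B) {xs = matrices (replicate d n)} A∈) , sym w≡

F-isMaximum : (n j k d : ℕ) → ∃ (TupleValue n j k d) → IsMaximum (TupleValue n j k d) (F n j k d)
F-isMaximum n j k d = max-isMaximum _ values to from
  where
  value : Fin d → Matrix (replicate d k) → ℕ
  value ℓ P = f n (tuple j ℓ P)

  permutations = filter isPermutation? (matrices (replicate d k))
  values = cartesianProductWith value (allFin d) permutations

  to : ∀ w → TupleValue n j k d w → w ∈ values
  to _ (ℓ , P , p , refl) with P′ , P′∈ , eq ← matrices-complete P =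
    subst (_∈ values)
      (sym (f-cong n (λ i → cong (_∧ true) (eq (quotients (replicate d k) (tupleShape j ℓ) i)))))
      (∈-cartesianProductWith⁺ value (∈-allFin ℓ)
        (∈-filter⁺ isPermutation? P′∈ (IsPermutation-resp eq p)))

  from : ∀ w → w ∈ values → TupleValue n j k d w
  from w w∈ with ℓ , P , _ , P∈ , w≡ ← ∈-cartesianProductWith⁻ value (allFin d) permutations w∈
    = ℓ , P , proj₂ (∈-filter⁻ isPermutation? {xs = matrices (replicate d k)} P∈) , sym w≡

-- c · h(n) ≤ g(n) ≤ C · h(n) eventually, for positive constants c and C.
-- For functions with values in ℕ the constants may be taken to be c = 1/a
-- and C = b with a and b positive integers.

_=Θ_ : (ℕ → ℕ) → (ℕ → ℕ) → Set
g =Θ h = ∃[ a ] ∃[ b ] 1 ≤ a × 1 ≤ b × ∃[ n₀ ] (∀ n → n₀ ≤ n → h n ≤ a * g n × g n ≤ b * h n)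

-- Lower bound: two ones of the same tuple differ only in the tuple coordinate,
-- so a single full cross section in that direction avoids every tuple matrix.
--
-- Upper bound, by induction on the number e = d ∸ 1 of remaining coordinates,
-- for all j at once.  Write the ones as points (y , x), x being the coordinate
-- in which the tuples extend.  Group the lines y into strips of side s, scan
-- each strip in direction x, and place a mark whenever some line of the strip
-- has received j ones since the previous mark.
--   * Two marks of a strip always enclose j ones on one line.  Hence the blocks
--     of side s that contain a mark avoid the 2-tuple matrix of the same
--     permutation, at scale n / s.
--   * Blocks with more than k marks: pigeonhole on the positions of k + 1 of
--     them.  In a fixed slab of blocks, those of one type avoid a
--     permutation matrix with one coordinate fewer.
--   * A mark is wide if the lines with a one between it and the previous mark
--     take k values in some coordinate ℓ of the strip.  Pigeonhole on k such
--     lines; the marks of one type in a fixed slab avoid a (j + 1)-tuple matrix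
--     with coordinate ℓ removed.
-- Any other mark accounts for at most j k ^ e ones, so the number g_j of ones
-- satisfies g_j(n) ≤ j k ^ (e + 1) g_2(n / s) + O(n ^ e).  For j = 2 and s large
-- this recursion sums geometrically, and for other j it is used once with s = 1.

module Submission where

open import Defs
open import Data.Bool.Base using (Bool; true; false; T; _∧_; if_then_else_)
open import Data.Bool.Properties using (T?; T-≡; T-∧; T-irrelevant)
open import Data.Fin.Base as Fin
  using (Fin; zero; suc; toℕ; fromℕ<; punchIn; punchOut; quotient; remainder; combine)
open import Data.Fin.Properties as Fin
  using (toℕ<n; toℕ-fromℕ<; fromℕ<-toℕ; toℕ-injective; punchIn-punchOut;
         toℕ-combine; combine-remQuot; remQuot-combine)
open import Data.List.Base as List
  using (List; []; _∷_; _++_; length; map; downFrom; cartesianProductWith; allFin; filterᵇ)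
open import Data.List.Membership.Propositional using (_∈_; find; lose)
open import Data.List.Membership.Propositional.Properties
  using (∈-cartesianProductWith⁺; ∈-cartesianProductWith⁻; ∈-downFrom⁺; ∈-downFrom⁻; ∈-allFin)
open import Data.List.Properties using (length-downFrom; length-tabulate)
open import Data.List.Relation.Unary.Any using (Any; any?; here; there)
open import Data.Nat.Base
open import Data.Nat.Properties
open import Data.Nat.Tactic.RingSolver using (solve-∀)
open import Data.Product.Base using (∃-syntax; _×_; _,_; proj₁; proj₂)
open import Data.Sum.Base using (_⊎_; inj₁; inj₂)
open import Data.Unit.Base using (tt)
open import Data.Vec.Base using (Vec; []; _∷_; lookup; insertAt; zipWith; tabulate; replicate)
open import Data.Vec.Properties
  using (lookup∘tabulate; lookup-zipWith; lookup-replicate; lookup∘update; lookup∘update′;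
         insertAt-lookup; insertAt-punchIn)
open import Data.Vec.Relation.Binary.Pointwise.Extensional using (ext; extensional⇒inductive)
open import Data.Vec.Relation.Binary.Pointwise.Inductive using (Pointwise; []; _∷_)
open import Data.Vec.Relation.Unary.All using ([]; _∷_)
open import Function.Base using (_∘_; id)
open import Function.Bundles using (module Equivalence)
open import Relation.Binary.Definitions using (tri<; tri≈; tri>)
open import Relation.Binary.PropositionalEquality
open import Relation.Nullary using (¬_; Dec; yes; no; contradiction)
open import Relation.Nullary.Decidable using (⌊_⌋; toWitness; fromWitness; _×-dec_; _→-dec_)

private variable
  X Y : Set
  d e : ℕ

-- Finite sums over lists.

∑ : List X → (X → ℕ) → ℕ
∑ []       g = 0
∑ (x ∷ xs) g = g x + ∑ xs g

syntax ∑ xs (λ x → t) = ∑[ x ∈ xs ] t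

infixr 10 ∑

∑-mono : (xs : List X) {g h : X → ℕ} → (∀ {x} → x ∈ xs → g x ≤ h x) → ∑ xs g ≤ ∑ xs h
∑-mono []       g≤h = z≤n
∑-mono (x ∷ xs) g≤h = +-mono-≤ (g≤h (here refl)) (∑-mono xs (g≤h ∘ there))

∑-cong : (xs : List X) {g h : X → ℕ} → (∀ x → g x ≡ h x) → ∑ xs g ≡ ∑ xs h
∑-cong []       g≡h = refl
∑-cong (x ∷ xs) g≡h = cong₂ _+_ (g≡h x) (∑-cong xs g≡h)

∑-const : (xs : List X) (c : ℕ) → ∑ xs (λ _ → c) ≡ length xs * c
∑-const []       c = refl
∑-const (x ∷ xs) c = cong (c +_) (∑-const xs c)

∑-≤-const : (xs : List X) {g : X → ℕ} {c : ℕ} → (∀ {x} → x ∈ xs → g x ≤ c) → ∑ xs g ≤ length xs * c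
∑-≤-const xs g≤c = ≤-trans (∑-mono xs g≤c) (≤-reflexive (∑-const xs _))

∑-+ : (xs : List X) (g h : X → ℕ) → ∑ xs (λ x → g x + h x) ≡ ∑ xs g + ∑ xs h
∑-+ []       g h = refl
∑-+ (x ∷ xs) g h = trans (cong ((g x + h x) +_) (∑-+ xs g h)) (eq (g x) (h x) (∑ xs g) (∑ xs h))
  where
  eq : ∀ a b c d → (a + b) + (c + d) ≡ (a + c) + (b + d)
  eq = solve-∀

∑-*ˡ : (xs : List X) (c : ℕ) (g : X → ℕ) → ∑ xs (λ x → c * g x) ≡ c * ∑ xs g
∑-*ˡ []       c g = sym (*-zeroʳ c)
∑-*ˡ (x ∷ xs) c g = trans (cong (c * g x +_) (∑-*ˡ xs c g)) (sym (*-distribˡ-+ c (g x) (∑ xs g)))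

∑-swap : (xs : List X) (ys : List Y) (g : X → Y → ℕ) →
         ∑ xs (λ x → ∑ ys (g x)) ≡ ∑ ys (λ y → ∑ xs (λ x → g x y))
∑-swap []       ys g = sym (trans (∑-const ys 0) (*-zeroʳ (length ys)))
∑-swap (x ∷ xs) ys g = trans (cong (∑ ys (g x) +_) (∑-swap xs ys g))
                             (sym (∑-+ ys (g x) (λ y → ∑ xs (λ x′ → g x′ y))))

∑-++ : (xs ys : List X) (g : X → ℕ) → ∑ (xs ++ ys) g ≡ ∑ xs g + ∑ ys g
∑-++ []       ys g = refl
∑-++ (x ∷ xs) ys g = trans (cong (g x +_) (∑-++ xs ys g)) (sym (+-assoc (g x) _ _))

∑-map : (f : X → Y) (xs : List X) (g : Y → ℕ) → ∑ (map f xs) g ≡ ∑ xs (g ∘ f)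
∑-map f []       g = refl
∑-map f (x ∷ xs) g = cong (g (f x) +_) (∑-map f xs g)

∑-cartesianProductWith : {Z : Set} (f : X → Y → Z) (xs : List X) (ys : List Y) (g : Z → ℕ) →
  ∑ (cartesianProductWith f xs ys) g ≡ ∑ xs (λ x → ∑ ys (λ y → g (f x y)))
∑-cartesianProductWith f []       ys g = refl
∑-cartesianProductWith f (x ∷ xs) ys g =
  trans (∑-++ (map (f x) ys) _ g)
        (cong₂ _+_ (∑-map (f x) ys g) (∑-cartesianProductWith f xs ys g))

term≤∑ : (xs : List X) (g : X → ℕ) {x : X} → x ∈ xs → g x ≤ ∑ xs g
term≤∑ (x ∷ xs) g (here refl) = m≤m+n _ _
term≤∑ (x ∷ xs) g (there x∈)  = ≤-trans (term≤∑ xs g x∈) (m≤n+m _ _)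

∑-downFrom-+ : ∀ m n (g : ℕ → ℕ) →
  ∑ (downFrom (m + n)) g ≡ ∑ (downFrom m) (λ x → g (x + n)) + ∑ (downFrom n) g
∑-downFrom-+ zero    n g = refl
∑-downFrom-+ (suc m) n g =
  trans (cong (g (m + n) +_) (∑-downFrom-+ m n g)) (sym (+-assoc (g (m + n)) _ _))

∑-downFrom-* : ∀ n s (g : ℕ → ℕ) →
  ∑ (downFrom (n * s)) g ≡ ∑ (downFrom n) (λ b → ∑ (downFrom s) (λ r → g (r + b * s)))
∑-downFrom-* zero    s g = refl
∑-downFrom-* (suc n) s g = trans (∑-downFrom-+ s (n * s) g)
  (cong (∑ (downFrom s) (λ r → g (r + n * s)) +_) (∑-downFrom-* n s g))

∑-downFrom-mono : ∀ {m n} (g : ℕ → ℕ) → m ≤ n → ∑ (downFrom m) g ≤ ∑ (downFrom n) g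
∑-downFrom-mono {m} g m≤n =
  subst (λ n → ∑ (downFrom m) g ≤ ∑ (downFrom n) g) (m∸n+n≡m m≤n)
    (≤-trans (m≤n+m _ _) (≤-reflexive (sym (∑-downFrom-+ (_ ∸ m) m g))))

-- Vectors over a list, boxes and their division into blocks.

tuples : (n : ℕ) → List X → List (Vec X n)
tuples zero    xs = [] ∷ []
tuples (suc n) xs = cartesianProductWith _∷_ xs (tuples n xs)

∈-tuples⁺ : ∀ {n} {xs : List X} {v : Vec X n} → (∀ i → lookup v i ∈ xs) → v ∈ tuples n xs
∈-tuples⁺ {v = []}    v∈ = here refl
∈-tuples⁺ {v = x ∷ v} v∈ = ∈-cartesianProductWith⁺ _∷_ (v∈ zero) (∈-tuples⁺ (v∈ ∘ suc))

∈-tuples⁻ : ∀ {n} {xs : List X} {v : Vec X n} → v ∈ tuples n xs → ∀ i → lookup v i ∈ xs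
∈-tuples⁻ {n = suc n} {xs} v∈ i
  with x , w , x∈ , w∈ , refl ← ∈-cartesianProductWith⁻ _∷_ xs (tuples n xs) v∈
  with i
... | zero  = x∈
... | suc i = ∈-tuples⁻ w∈ i

∑-tuples : ∀ n (xs : List X) (g : Vec X (suc n) → ℕ) →
  ∑ (tuples (suc n) xs) g ≡ ∑ xs (λ x → ∑ (tuples n xs) (λ v → g (x ∷ v)))
∑-tuples n xs g = ∑-cartesianProductWith _∷_ xs (tuples n xs) g

length-tuples : ∀ n (xs : List X) → length (tuples n xs) ≡ length xs ^ n
length-tuples zero    xs = refl
length-tuples (suc n) xs = begin
  length (tuples (suc n) xs)                      ≡⟨ length≡∑ (tuples (suc n) xs) ⟩
  ∑ (tuples (suc n) xs) (λ _ → 1)                 ≡⟨ ∑-tuples n xs _ ⟩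
  ∑ xs (λ _ → ∑ (tuples n xs) (λ _ → 1))          ≡⟨ ∑-const xs _ ⟩
  length xs * ∑ (tuples n xs) (λ _ → 1)           ≡⟨ cong (length xs *_) (length≡∑ (tuples n xs)) ⟨
  length xs * length (tuples n xs)                ≡⟨ cong (length xs *_) (length-tuples n xs) ⟩
  length xs ^ suc n                               ∎
  where
  open ≡-Reasoning
  length≡∑ : {Z : Set} (zs : List Z) → length zs ≡ ∑ zs (λ _ → 1)
  length≡∑ zs = sym (trans (∑-const zs 1) (*-identityʳ _))

-- Splits off an arbitrary coordinate instead of the first one: needed for slabs orthogonal to `ℓ`
-- and for tuples that extend in any direction.
∑-tuples-insertAt : ∀ n (xs : List X) (ℓ : Fin (suc n)) (g : Vec X (suc n) → ℕ) →
  ∑ (tuples (suc n) xs) g ≡ ∑ xs (λ x → ∑ (tuples n xs) (λ v → g (insertAt v ℓ x)))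
∑-tuples-insertAt n xs zero g = trans (∑-tuples n xs g)
    (∑-cong xs λ _ → ∑-cong (tuples n xs) λ { [] → refl ; (_ ∷ _) → refl })
∑-tuples-insertAt (suc n) xs (suc ℓ) g = begin
  ∑ (tuples (suc (suc n)) xs) g
    ≡⟨ ∑-tuples (suc n) xs g ⟩
  ∑ xs (λ y → ∑ (tuples (suc n) xs) (λ w → g (y ∷ w)))
    ≡⟨ ∑-cong xs (λ y → ∑-tuples-insertAt n xs ℓ (λ w → g (y ∷ w))) ⟩
  ∑ xs (λ y → ∑ xs (λ x → ∑ (tuples n xs) (λ v → g (y ∷ insertAt v ℓ x))))
    ≡⟨ ∑-swap xs xs _ ⟩
  ∑ xs (λ x → ∑ xs (λ y → ∑ (tuples n xs) (λ v → g (y ∷ insertAt v ℓ x))))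
    ≡⟨ ∑-cong xs (λ x → ∑-tuples n xs (λ v → g (insertAt v (suc ℓ) x))) ⟨
  ∑ xs (λ x → ∑ (tuples (suc n) xs) (λ v → g (insertAt v (suc ℓ) x))) ∎
  where open ≡-Reasoning

box : (e n : ℕ) → List (Vec ℕ e)
box e n = tuples e (downFrom n)

length-box : ∀ e n → length (box e n) ≡ n ^ e
length-box e n = trans (length-tuples e (downFrom n)) (cong (_^ e) (length-downFrom n))

∑-box-mono : ∀ e {m n} (g : Vec ℕ e → ℕ) → m ≤ n → ∑ (box e m) g ≤ ∑ (box e n) g
∑-box-mono zero    g m≤n = ≤-refl
∑-box-mono (suc e) {m} {n} g m≤n = begin
  ∑ (box (suc e) m) g                                          ≡⟨ ∑-tuples e (downFrom m) g ⟩
  ∑ (downFrom m) (λ x → ∑ (box e m) (λ v → g (x ∷ v)))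
    ≤⟨ ∑-mono (downFrom m) (λ {x} _ → ∑-box-mono e (λ v → g (x ∷ v)) m≤n) ⟩
  ∑ (downFrom m) (λ x → ∑ (box e n) (λ v → g (x ∷ v)))         ≤⟨ ∑-downFrom-mono _ m≤n ⟩
  ∑ (downFrom n) (λ x → ∑ (box e n) (λ v → g (x ∷ v)))         ≡⟨ ∑-tuples e (downFrom n) g ⟨
  ∑ (box (suc e) n) g                                          ∎
  where open ≤-Reasoning

-- The point with offset `r` inside the block with index `b`, for blocks of side `s`.
place : ℕ → Vec ℕ e → Vec ℕ e → Vec ℕ e
place s = zipWith (λ b r → r + b * s)

∑-box-blocks : ∀ e n s (g : Vec ℕ e → ℕ) →
  ∑ (box e (n * s)) g ≡ ∑ (box e n) (λ Y → ∑ (box e s) (λ o → g (place s Y o)))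
∑-box-blocks zero    n s g = sym (+-identityʳ _)
∑-box-blocks (suc e) n s g = begin
  ∑ (box (suc e) (n * s)) g
    ≡⟨ ∑-tuples e (downFrom (n * s)) g ⟩
  ∑ (downFrom (n * s)) (λ x → ∑ (box e (n * s)) (λ v → g (x ∷ v)))
    ≡⟨ ∑-downFrom-* n s _ ⟩
  ∑ (downFrom n) (λ b → ∑ (downFrom s) (λ r → ∑ (box e (n * s)) (λ v → g (r + b * s ∷ v))))
    ≡⟨ ∑-cong (downFrom n) (λ b → ∑-cong (downFrom s) λ r → ∑-box-blocks e n s _) ⟩
  ∑ (downFrom n) (λ b → ∑ (downFrom s) (λ r →
    ∑ (box e n) (λ Y → ∑ (box e s) (λ o → g (r + b * s ∷ place s Y o)))))
    ≡⟨ ∑-cong (downFrom n) (λ b → ∑-swap (downFrom s) (box e n) _) ⟩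
  ∑ (downFrom n) (λ b → ∑ (box e n) (λ Y →
    ∑ (downFrom s) (λ r → ∑ (box e s) (λ o → g (r + b * s ∷ place s Y o)))))
    ≡⟨ ∑-cong (downFrom n) (λ b → ∑-cong (box e n) λ Y → ∑-tuples e (downFrom s) _) ⟨
  ∑ (downFrom n) (λ b → ∑ (box e n) (λ Y → ∑ (box (suc e) s) (λ o → g (place s (b ∷ Y) o))))
    ≡⟨ ∑-tuples e (downFrom n) _ ⟨
  ∑ (box (suc e) n) (λ Y → ∑ (box (suc e) s) (λ o → g (place s Y o))) ∎
  where open ≡-Reasoning

-- Indicators and counting along a line.

⟦_⟧ : Bool → ℕ
⟦ true  ⟧ = 1
⟦ false ⟧ = 0

⟦⟧≤1 : ∀ b → ⟦ b ⟧ ≤ 1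
⟦⟧≤1 true  = ≤-refl
⟦⟧≤1 false = z≤n

⟦⟧≤ : ∀ b {m} → (T b → 1 ≤ m) → ⟦ b ⟧ ≤ m
⟦⟧≤ true  h = h tt
⟦⟧≤ false h = z≤n

1≤⟦⟧ : ∀ {b} → T b → 1 ≤ ⟦ b ⟧
1≤⟦⟧ {true} _ = ≤-refl

opaque
  count : (ℕ → Bool) → ℕ → ℕ
  count a n = ∑[ x ∈ downFrom n ] ⟦ a x ⟧

  count≡∑ : ∀ (a : ℕ → Bool) n → count a n ≡ ∑ (downFrom n) (λ x → ⟦ a x ⟧)
  count≡∑ a n = refl

  count-zero : ∀ (a : ℕ → Bool) → count a 0 ≡ 0
  count-zero a = refl

  count-mono : ∀ (a : ℕ → Bool) {m n} → m ≤ n → count a m ≤ count a n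
  count-mono a = ∑-downFrom-mono (λ x → ⟦ a x ⟧)

  count-⊆ : ∀ (a b : ℕ → Bool) n → (∀ {x} → x < n → T (a x) → T (b x)) → count a n ≤ count b n
  count-⊆ a b n a⊆b = ∑-mono (downFrom n) λ {x} x∈ → ⟦⟧≤ (a x) (1≤⟦⟧ ∘ a⊆b (∈-downFrom⁻ x∈))

  count-suc : ∀ (a : ℕ → Bool) {x} → T (a x) → count a (suc x) ≡ suc (count a x)
  count-suc a {x} ax with a x
  ... | true = refl

  count-same : ∀ (a : ℕ → Bool) {x} → ¬ T (a x) → count a (suc x) ≡ count a x
  count-same a {x} ¬ax with a x
  ... | true  = contradiction tt ¬ax
  ... | false = refl

  count-suc≤ : ∀ (a : ℕ → Bool) x → count a (suc x) ≤ suc (count a x)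
  count-suc≤ a x = +-monoˡ-≤ (count a x) (⟦⟧≤1 (a x))

  count≤ : ∀ (a : ℕ → Bool) n → count a n ≤ n
  count≤ a zero    = z≤n
  count≤ a (suc n) = ≤-trans (count-suc≤ a n) (s≤s (count≤ a n))

  nth : ∀ (a : ℕ → Bool) {t n} → t < count a n → ∃[ x ] (x < n × T (a x) × count a x ≡ t)
  nth a {t} {suc n} t< with t <? count a n
  ... | yes t<′ with x , x<n , ax , eq ← nth a t<′ = x , m<n⇒m<1+n x<n , ax , eq
  ... | no  t≮  with a n in an
  ...   | false = contradiction t< t≮
  ...   | true  = n , ≤-refl , subst T (sym an) tt , ≤-antisym (≮⇒≥ t≮) (s≤s⁻¹ t<)

count-cancel-< : ∀ (a : ℕ → Bool) {m n} → count a m < count a n → m < n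
count-cancel-< a lt = ≰⇒> λ n≤m → <⇒≱ lt (count-mono a n≤m)

-- Unpacks a dense window: it yields the one of rank `t` inside the window. A one at `x` below `u`
-- would already be counted in `count a u`, which excludes `x < u`.
nth-from : ∀ (a : ℕ → Bool) {t u v} → t + count a u < count a v →
  ∃[ x ] (u ≤ x × x < v × T (a x) × count a x ≡ t + count a u)
nth-from a {t} {u} lt with x , x<v , ax , eq ← nth a lt = x , u≤x , x<v , ax , eq
  where
  u≤x : u ≤ x
  u≤x = ≮⇒≥ λ x<u → <⇒≱ (n<1+n (count a x)) (begin
    suc (count a x)  ≡⟨ count-suc a ax ⟨
    count a (suc x)  ≤⟨ count-mono a x<u ⟩
    count a u        ≤⟨ m≤n+m _ t ⟩
    t + count a u    ≡⟨ eq ⟨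
    count a x        ∎)
    where open ≤-Reasoning

-- Pigeonhole on increasing tuples.

Spread : ∀ {k} → (X → ℕ) → (X → Bool) → Vec X k → Set
Spread f S τ = (∀ a b → a Fin.< b → f (lookup τ a) < f (lookup τ b)) × (∀ a → T (S (lookup τ a)))

spread? : ∀ {k} (f : X → ℕ) (S : X → Bool) (τ : Vec X k) → Dec (Spread f S τ)
spread? f S τ =
  (Fin.all? λ a → Fin.all? λ b → (a Fin.<? b) →-dec (f (lookup τ a) <? f (lookup τ b)))
  ×-dec Fin.all? λ a → T? (S (lookup τ a))

opaque
  spread : ∀ {k} → (X → ℕ) → (X → Bool) → Vec X k → Bool
  spread f S τ = ⌊ spread? f S τ ⌋

  Spread⇒spread : ∀ {k f S} {τ : Vec X k} → Spread f S τ → T (spread f S τ)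
  Spread⇒spread {f = f} {S} {τ} = fromWitness {a? = spread? f S τ}

  spread⇒Spread : ∀ {k f S} {τ : Vec X k} → T (spread f S τ) → Spread f S τ
  spread⇒Spread {f = f} {S} {τ} = toWitness {a? = spread? f S τ}

attains? : (f : X → ℕ) (S : X → Bool) (xs : List X) (v : ℕ) →
           Dec (Any (λ x → T (S x) × f x ≡ v) xs)
attains? f S xs v = any? (λ x → T? (S x) ×-dec f x ≟ v) xs

attains : (X → ℕ) → (X → Bool) → List X → ℕ → Bool
attains f S xs v = ⌊ attains? f S xs v ⌋

-- Take the `k` smallest attained values and one element of `S` for each. The resulting `τ` is the
-- type in the pigeonhole arguments: it comes from a fixed finite list, so the same `τ` can be
-- shared by many blocks or marks.
spread-exists : ∀ k (f : X → ℕ) (S : X → Bool) (xs : List X) s →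
  k ≤ count (attains f S xs) s → 1 ≤ ∑ (tuples k xs) (λ τ → ⟦ spread f S τ ⟧)
spread-exists {X} k f S xs s k≤ =
  ≤-trans (1≤⟦⟧ (Spread⇒spread {f = f} {S} {τ} (increasing , inside)))
          (term≤∑ (tuples k xs) (λ τ → ⟦ spread f S τ ⟧) (∈-tuples⁺ {v = τ} members))
  where
  value : ∀ (a : Fin k) → _
  value a = nth (attains f S xs) {n = s} (<-≤-trans (toℕ<n a) k≤)

  point : ∀ (a : Fin k) → ∃[ x ] (x ∈ xs × T (S x) × f x ≡ proj₁ (value a))
  point a = find (toWitness {a? = attains? f S xs (proj₁ (value a))}
      (proj₁ (proj₂ (proj₂ (value a)))))

  τ : Vec X k
  τ = tabulate (proj₁ ∘ point)

  τ≡ : ∀ a → lookup τ a ≡ proj₁ (point a)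
  τ≡ = lookup∘tabulate (proj₁ ∘ point)

  members : ∀ a → lookup τ a ∈ xs
  members a = subst (_∈ xs) (sym (τ≡ a)) (proj₁ (proj₂ (point a)))

  inside : ∀ a → T (S (lookup τ a))
  inside a = subst (T ∘ S) (sym (τ≡ a)) (proj₁ (proj₂ (proj₂ (point a))))

  f≡ : ∀ a → f (lookup τ a) ≡ proj₁ (value a)
  f≡ a = trans (cong f (τ≡ a)) (proj₂ (proj₂ (proj₂ (point a))))

  increasing : ∀ a b → a Fin.< b → f (lookup τ a) < f (lookup τ b)
  increasing a b a<b = subst₂ _<_ (sym (f≡ a)) (sym (f≡ b))
    (count-cancel-< (attains f S xs)
      (subst₂ _<_ (sym (proj₂ (proj₂ (proj₂ (value a)))))
          (sym (proj₂ (proj₂ (proj₂ (value b))))) a<b))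

-- Either at most `k` elements are present and the indicator of nonemptiness pays for them, or an
-- increasing tuple of length `k + 1` exists and pays for all `s` positions.
count-≤-spread : ∀ k (S : ℕ → Bool) s →
  count S s ≤ k * ⟦ ⌊ 1 ≤? count S s ⌋ ⟧
              + s * ∑ (tuples (suc k) (downFrom s)) (λ t → ⟦ spread id S t ⟧)
count-≤-spread k S s with suc k ≤? count (attains id S (downFrom s)) s
... | yes k< = begin
  count S s                                                       ≤⟨ count≤ S s ⟩
  s                                                               ≡⟨ *-identityʳ s ⟨
  s * 1
    ≤⟨ *-monoʳ-≤ s (spread-exists (suc k) id S (downFrom s) s k<) ⟩
  s * ∑ (tuples (suc k) (downFrom s)) (λ t → ⟦ spread id S t ⟧)   ≤⟨ m≤n+m _ _ ⟩
  _                                                               ∎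
  where open ≤-Reasoning
... | no k≮ = ≤-trans few (m≤m+n _ _)
  where
  open ≤-Reasoning
  count≤k : count S s ≤ k
  count≤k = begin
    count S s
      ≤⟨ count-⊆ S (attains id S (downFrom s)) s (λ {x} x<s Sx →
           fromWitness {a? = attains? id S (downFrom s) x} (lose (∈-downFrom⁺ x<s) (Sx , refl))) ⟩
    count (attains id S (downFrom s)) s      ≤⟨ s≤s⁻¹ (≰⇒> k≮) ⟩
    k                                        ∎

  few : count S s ≤ k * ⟦ ⌊ 1 ≤? count S s ⌋ ⟧
  few with 1 ≤? count S s
  ... | yes _  = ≤-trans count≤k (≤-reflexive (sym (*-identityʳ k)))
  ... | no  0≮ = ≤-trans (s≤s⁻¹ (≰⇒> 0≮)) z≤n

-- When each `g ℓ` is an indicator this is the indicator of a product set. A set lies inside the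
-- product of its projections, which is how its size is bounded below.
weight : ∀ e → (Fin e → X → ℕ) → Vec X e → ℕ
weight zero    g []       = 1
weight (suc e) g (x ∷ xs) = g zero x * weight e (g ∘ suc) xs

1≤weight : ∀ e (g : Fin e → X → ℕ) (v : Vec X e) → (∀ ℓ → 1 ≤ g ℓ (lookup v ℓ)) → 1 ≤ weight e g v
1≤weight zero    g []      1≤g = ≤-refl
1≤weight (suc e) g (x ∷ v) 1≤g = *-mono-≤ (1≤g zero) (1≤weight e (g ∘ suc) v (1≤g ∘ suc))

∑-weight≤ : ∀ e k (xs : List X) (g : Fin e → X → ℕ) → (∀ ℓ → ∑ xs (g ℓ) ≤ k) →
            ∑ (tuples e xs) (weight e g) ≤ k ^ e
∑-weight≤ zero    k xs g g≤ = ≤-refl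
∑-weight≤ (suc e) k xs g g≤ = begin
  ∑ (tuples (suc e) xs) (weight (suc e) g)
    ≡⟨ ∑-tuples e xs _ ⟩
  ∑ xs (λ x → ∑ (tuples e xs) (λ v → g zero x * weight e (g ∘ suc) v))
    ≡⟨ ∑-cong xs (λ x → trans (∑-*ˡ (tuples e xs) (g zero x) _) (*-comm (g zero x) _)) ⟩
  ∑ xs (λ x → ∑ (tuples e xs) (weight e (g ∘ suc)) * g zero x)
    ≡⟨ ∑-*ˡ xs (∑ (tuples e xs) (weight e (g ∘ suc))) (g zero) ⟩
  ∑ (tuples e xs) (weight e (g ∘ suc)) * ∑ xs (g zero)
    ≡⟨ *-comm _ (∑ xs (g zero)) ⟩
  ∑ xs (g zero) * ∑ (tuples e xs) (weight e (g ∘ suc))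
    ≤⟨ *-mono-≤ (g≤ zero) (∑-weight≤ e k xs (g ∘ suc) (g≤ ∘ suc)) ⟩
  k ^ suc e ∎
  where open ≤-Reasoning

-- A set of more than k ^ e points takes at least k values in some coordinate.
∑-box-≤-spread : ∀ k e s (S : Vec ℕ e → Bool) →
  ∑ (box e s) (λ o → ⟦ S o ⟧) ≤
  k ^ e + s ^ e * ∑ (allFin e) (λ ℓ →
      ∑ (tuples k (box e s)) (λ τ → ⟦ spread (λ o → lookup o ℓ) S τ ⟧))
∑-box-≤-spread k e s S
  with Fin.any? (λ ℓ → k ≤? count (attains (λ o → lookup o ℓ) S (box e s)) s)
... | yes (ℓ , k≤) = begin
  ∑ (box e s) (λ o → ⟦ S o ⟧)                 ≤⟨ ∑-≤-const (box e s) (λ {o} _ → ⟦⟧≤1 (S o)) ⟩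
  length (box e s) * 1                        ≡⟨ cong (_* 1) (length-box e s) ⟩
  s ^ e * 1                                   ≤⟨ *-monoʳ-≤ (s ^ e) (≤-trans
         (spread-exists k (λ o → lookup o ℓ) S (box e s) s k≤)
         (term≤∑ (allFin e)
           (λ ℓ → ∑ (tuples k (box e s)) (λ τ → ⟦ spread (λ o → lookup o ℓ) S τ ⟧)) (∈-allFin ℓ))) ⟩
  s ^ e * _                                   ≤⟨ m≤n+m _ (k ^ e) ⟩
  _                                           ∎
  where open ≤-Reasoning
... | no few = ≤-trans (begin
  ∑ (box e s) (λ o → ⟦ S o ⟧)
    ≤⟨ ∑-mono (box e s) (λ {o} o∈ → ⟦⟧≤ (S o) λ So → 1≤weight e g o λ ℓ →
         1≤⟦⟧ (fromWitness {a? = attains? (λ o → lookup o ℓ) S (box e s) (lookup o ℓ)}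
                 (lose o∈ (So , refl)))) ⟩
  ∑ (box e s) (weight e g)
    ≤⟨ ∑-weight≤ e k (downFrom s) g
        (λ ℓ → ≤-trans (≤-reflexive (sym (count≡∑ (attains (λ o → lookup o ℓ) S (box e s)) s)))
                       (<⇒≤ (≰⇒> λ k≤ → few (ℓ , k≤)))) ⟩
  k ^ e                         ∎) (m≤m+n _ _)
  where
  open ≤-Reasoning
  g : Fin e → ℕ → ℕ
  g ℓ v = ⟦ attains (λ o → lookup o ℓ) S (box e s) v ⟧

-- Scanning a strip of lines and placing marks.

module Scan {O : Set} (lines : List O) (a : O → ℕ → Bool) (j : ℕ) where

  opaque
    full? : ∀ r x → Dec (Any (λ o → j + count (a o) r ≤ count (a o) (suc x)) lines)
    full? r x = any? (λ o → j + count (a o) r ≤? count (a o) (suc x)) lines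

    -- `reset x` is the position just after the last mark below `x`, or 0 if there is none. A mark
    -- at `x` closes the interval from `reset x` to `x`, both ends included.
    reset : ℕ → ℕ
    mark  : ℕ → Bool

    reset zero    = 0
    reset (suc x) = if mark x then suc x else reset x

    mark x = ⌊ full? (reset x) x ⌋

    reset-zero : reset 0 ≡ 0
    reset-zero = refl

    reset-suc : ∀ {x} → mark x ≡ true → reset (suc x) ≡ suc x
    reset-suc mx rewrite mx = refl

    reset-same : ∀ {x} → mark x ≡ false → reset (suc x) ≡ reset x
    reset-same ¬mx rewrite ¬mx = refl

    mark⇒full : ∀ {x} → T (mark x) →
      ∃[ o ] (o ∈ lines × j + count (a o) (reset x) ≤ count (a o) (suc x))
    mark⇒full {x} mx = find (toWitness {a? = full? (reset x) x} mx)

    full⇒mark : ∀ {x o} → o ∈ lines → j + count (a o) (reset x) ≤ count (a o) (suc x) → T (mark x)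
    full⇒mark {x} o∈ full = fromWitness {a? = full? (reset x) x} (lose o∈ full)

  active : O → ℕ → Bool
  active o x = count (a o) (reset x) <ᵇ count (a o) (suc x)

  reset≤ : ∀ x → reset x ≤ x
  reset≤ zero    = ≤-reflexive reset-zero
  reset≤ (suc x) with mark x in mx
  ... | true  = ≤-reflexive (reset-suc mx)
  ... | false = ≤-trans (≤-reflexive (reset-same mx)) (m≤n⇒m≤1+n (reset≤ x))

  reset-mono-suc : ∀ x → reset x ≤ reset (suc x)
  reset-mono-suc x with mark x in mx
  ... | true  = ≤-trans (m≤n⇒m≤1+n (reset≤ x)) (≤-reflexive (sym (reset-suc mx)))
  ... | false = ≤-reflexive (sym (reset-same mx))

  mark⇒<reset : ∀ {x y} → T (mark x) → x < y → x < reset y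
  mark⇒<reset {x} {suc y} mx x<1+y with m<1+n⇒m<n∨m≡n x<1+y
  ... | inj₁ x<y  = <-≤-trans (mark⇒<reset mx x<y) (reset-mono-suc y)
  ... | inj₂ refl = ≤-reflexive (sym (reset-suc (Equivalence.to T-≡ mx)))

  -- The interval closed by the mark `y` begins after `x`, because the mark at `x` has reset the
  -- scan.
  between-marks : ∀ {x y} → T (mark x) → T (mark y) → x < y →
    ∃[ o ] (o ∈ lines × j + count (a o) (suc x) ≤ count (a o) (suc y))
  between-marks {x} {y} mx my x<y with o , o∈ , h ← mark⇒full my =
    o , o∈ , ≤-trans (+-monoʳ-≤ j (count-mono (a o) (mark⇒<reset mx x<y))) h

  -- A line that reaches `j` ones produces a mark at that very position, and the reset then makes
  -- its current count zero.
  sparse : 1 ≤ j → ∀ {o} → o ∈ lines → ∀ x → count (a o) x < j + count (a o) (reset x)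
  sparse 1≤j {o} o∈ zero rewrite reset-zero = +-monoˡ-≤ (count (a o) 0) 1≤j
  sparse 1≤j {o} o∈ (suc x) with mark x in mx
  ... | true  rewrite reset-suc mx  = +-monoˡ-≤ (count (a o) (suc x)) 1≤j
  ... | false rewrite reset-same mx = ≰⇒> λ h → subst T mx (full⇒mark o∈ h)

  -- By `sparse` a line has fewer than `j` ones before `x` in the current interval, and the position
  -- `x` adds at most one more; an inactive line has none.
  gain≤ : 1 ≤ j → ∀ {o} → o ∈ lines → ∀ x →
          count (a o) (suc x) ≤ count (a o) (reset x) + j * ⟦ active o x ⟧
  gain≤ 1≤j {o} o∈ x with count (a o) (reset x) <ᵇ count (a o) (suc x) in lt
  ... | true = begin
    count (a o) (suc x)            ≤⟨ count-suc≤ (a o) x ⟩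
    suc (count (a o) x)            ≤⟨ sparse 1≤j o∈ x ⟩
    j + count (a o) (reset x)      ≡⟨ +-comm j _ ⟩
    count (a o) (reset x) + j      ≡⟨ cong (count (a o) (reset x) +_) (*-identityʳ j) ⟨
    count (a o) (reset x) + j * 1  ∎
    where open ≤-Reasoning
  ... | false = ≤-trans (≮⇒≥ λ c< → subst T lt (<⇒<ᵇ c<)) (m≤m+n _ _)

  -- Every one below `reset x` lies in the interval closed by some mark, where its line is active
  -- and holds at most `j` ones.
  recorded : 1 ≤ j → ∀ x →
    ∑ lines (λ o → count (a o) (reset x)) ≤
    j * ∑ (downFrom x) (λ y → ⟦ mark y ⟧ * ∑ lines (λ o → ⟦ active o y ⟧))
  recorded 1≤j zero rewrite reset-zero =
    ≤-trans (≤-reflexive (trans (∑-cong lines (λ o → count-zero (a o)))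
        (trans (∑-const lines 0) (*-zeroʳ (length lines))))) z≤n
  recorded 1≤j (suc x) with mark x in mx
  ... | false rewrite reset-same mx = recorded 1≤j x
  ... | true  rewrite reset-suc mx  = begin
    ∑ lines (λ o → count (a o) (suc x))
      ≤⟨ ∑-mono lines (λ o∈ → gain≤ 1≤j o∈ x) ⟩
    ∑ lines (λ o → count (a o) (reset x) + j * ⟦ active o x ⟧)
      ≡⟨ trans (∑-+ lines _ _) (cong (∑ lines (λ o → count (a o) (reset x)) +_) (∑-*ˡ lines j _)) ⟩
    ∑ lines (λ o → count (a o) (reset x)) + j * A
      ≤⟨ +-monoˡ-≤ (j * A) (recorded 1≤j x) ⟩
    j * B + j * A
      ≡⟨ eq j A B ⟩
    j * (1 * A + B) ∎
    where
    open ≤-Reasoning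
    A = ∑ lines (λ o → ⟦ active o x ⟧)
    B = ∑ (downFrom x) (λ y → ⟦ mark y ⟧ * ∑ lines (λ o → ⟦ active o y ⟧))
    eq : ∀ j A B → j * B + j * A ≡ j * (1 * A + B)
    eq = solve-∀

  -- Adds to `recorded` the last, unclosed interval, in which each line has fewer than `j` ones.
  ∑-count≤ : 1 ≤ j → ∀ x →
    ∑ lines (λ o → count (a o) x) ≤
    j * length lines + j * ∑ (downFrom x) (λ y → ⟦ mark y ⟧ * ∑ lines (λ o → ⟦ active o y ⟧))
  ∑-count≤ 1≤j x = begin
    ∑ lines (λ o → count (a o) x)
      ≤⟨ ∑-mono lines (λ o∈ → <⇒≤ (sparse 1≤j o∈ x)) ⟩
    ∑ lines (λ o → j + count (a o) (reset x))
      ≡⟨ trans (∑-+ lines _ _) (cong (_+ ∑ lines (λ o → count (a o) (reset x)))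
          (trans (∑-const lines j) (*-comm (length lines) j))) ⟩
    j * length lines + ∑ lines (λ o → count (a o) (reset x))
      ≤⟨ +-monoʳ-≤ (j * length lines) (recorded 1≤j x) ⟩
    _ ∎
    where open ≤-Reasoning

  -- Consecutive marks delimit disjoint intervals; only the interval of the
  -- first mark of [u, v) can reach below u, which costs one unit.
  active-marks : (o : O) (W : ℕ → Bool) → (∀ {x} → T (W x) → T (mark x) × T (active o x)) →
    ∀ i {u v} → suc i + count W u ≤ count W v → i + count (a o) u ≤ count (a o) v
  active-marks o W W⇒ i {u} {v} dense with invariant v (<⇒≤ u<v)
    where
    u<v : u < v
    u<v = count-cancel-< W (≤-trans (s≤s (m≤n+m _ i)) dense)

    -- Ones are compared only up to `reset v`. The interval of the next mark thus remains uncounted,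
    -- and an active line gains a new one there. The first alternative is the case in which `W` has
    -- no element between `u` and `v`.
    invariant : ∀ v → u ≤ v →
      count W v ≡ count W u ⊎ count W v + count (a o) u ≤ suc (count W u + count (a o) (reset v))
    invariant v u≤v with m≤n⇒m<n∨m≡n u≤v
    invariant v       _ | inj₂ refl = inj₁ refl
    invariant (suc v) _ | inj₁ u<1+v with T? (W v) | invariant v (s≤s⁻¹ u<1+v)
    ... | no ¬Wv | inj₁ eq = inj₁ (trans (count-same W ¬Wv) eq)
    ... | no ¬Wv | inj₂ h  = inj₂ (≤-trans
        (≤-reflexive (cong (_+ count (a o) u) (count-same W ¬Wv)))
            (≤-trans h (s≤s (+-monoʳ-≤ (count W u) (count-mono (a o) (reset-mono-suc v))))))
    ... | yes Wv | h with mv , av ← W⇒ Wv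
      rewrite reset-suc (Equivalence.to T-≡ mv) | count-suc W Wv = inj₂ (s≤s (bound h))
      where
      open ≤-Reasoning
      bound : _ → count W v + count (a o) u ≤ count W u + count (a o) (suc v)
      bound (inj₁ eq) = +-mono-≤ (≤-reflexive eq) (count-mono (a o) (<⇒≤ u<1+v))
      bound (inj₂ h)  = begin
        count W v + count (a o) u                    ≤⟨ h ⟩
        suc (count W u + count (a o) (reset v))      ≡⟨ +-suc (count W u) _ ⟨
        count W u + suc (count (a o) (reset v))
          ≤⟨ +-monoʳ-≤ (count W u) (<ᵇ⇒< (count (a o) (reset v)) _ av) ⟩
        count W u + count (a o) (suc v)              ∎
  ... | inj₁ eq = contradiction (≤-trans dense (≤-reflexive eq)) (irreflexive i)
    where
    irreflexive : ∀ i → ¬ (suc i + count W u ≤ count W u)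
    irreflexive i h = <⇒≱ (s≤s (m≤n+m _ i)) h
  ... | inj₂ h = ≤-trans (+-cancelˡ-≤ (suc (count W u)) _ _ (begin
      suc (count W u) + (i + count (a o) u)     ≡⟨ eq (count W u) i (count (a o) u) ⟩
      suc i + count W u + count (a o) u         ≤⟨ +-monoˡ-≤ _ dense ⟩
      count W v + count (a o) u                 ≤⟨ h ⟩
      suc (count W u) + count (a o) (reset v)   ∎)) (count-mono (a o) (reset≤ v))
    where
    open ≤-Reasoning
    eq : ∀ w i c → suc w + (i + c) ≡ suc i + w + c
    eq = solve-∀

-- Order of points in blocks, totals, and rounding sizes to powers.

∑-swap₃ : {Z : Set} (xs : List X) (ys : List Y) (zs : List Z) (g : X → Y → Z → ℕ) →
  ∑ xs (λ x → ∑ ys (λ y → ∑ zs (g x y))) ≡ ∑ ys (λ y → ∑ zs (λ z → ∑ xs (λ x → g x y z)))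
∑-swap₃ xs ys zs g = trans (∑-swap xs ys (λ x y → ∑ zs (g x y)))
                           (∑-cong ys λ y → ∑-swap xs zs (λ x → g x y))

∑-linear : (xs : List X) (a b : ℕ) (g h : X → ℕ) →
  ∑ xs (λ x → a * g x + b * h x) ≡ a * ∑ xs g + b * ∑ xs h
∑-linear xs a b g h = trans (∑-+ xs _ _) (cong₂ _+_ (∑-*ˡ xs a g) (∑-*ˡ xs b h))

∈-box⁻ : ∀ e n {v : Vec ℕ e} → v ∈ box e n → ∀ ℓ → lookup v ℓ < n
∈-box⁻ e n v∈ ℓ = ∈-downFrom⁻ (∈-tuples⁻ v∈ ℓ)

spread-≤ : ∀ {k} {f : X → ℕ} {S : X → Bool} {τ : Vec X k} → Spread f S τ →
  ∀ {a b} → toℕ a ≤ toℕ b → f (lookup τ a) ≤ f (lookup τ b)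
spread-≤ {f = f} {τ = τ} (increasing , _) {a} {b} a≤b with m≤n⇒m<n∨m≡n a≤b
... | inj₁ a<b = <⇒≤ (increasing a b a<b)
... | inj₂ a≡b = ≤-reflexive (cong (f ∘ lookup τ) (toℕ-injective a≡b))

remainder-< : ∀ {s o X X′} o′ → o < s → X < X′ → o + X * s < o′ + X′ * s
remainder-< {s} {o} {X} {X′} o′ o<s X<X′ = begin-strict
  o + X * s     <⟨ +-monoˡ-< (X * s) o<s ⟩
  suc X * s     ≤⟨ *-monoˡ-≤ s X<X′ ⟩
  X′ * s        ≤⟨ m≤n+m _ o′ ⟩
  o′ + X′ * s   ∎
  where open ≤-Reasoning

lookup-place : ∀ s (Y o : Vec ℕ e) ℓ → lookup (place s Y o) ℓ ≡ lookup o ℓ + lookup Y ℓ * s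
lookup-place s Y o ℓ = lookup-zipWith _ ℓ Y o

place-< : ∀ s (Y Y′ o o′ : Vec ℕ e) ℓ → lookup o ℓ < s → lookup Y ℓ < lookup Y′ ℓ →
          lookup (place s Y o) ℓ < lookup (place s Y′ o′) ℓ
place-< s Y Y′ o o′ ℓ o<s Y<Y′ =
  subst₂ _<_ (sym (lookup-place s Y o ℓ)) (sym (lookup-place s Y′ o′ ℓ))
      (remainder-< (lookup o′ ℓ) o<s Y<Y′)

^-distribʳ-* : ∀ o m n → (m * n) ^ o ≡ m ^ o * n ^ o
^-distribʳ-* zero    m n = refl
^-distribʳ-* (suc o) m n = trans (cong (m * n *_) (^-distribʳ-* o m n)) (eq m n (m ^ o) (n ^ o))
  where
  eq : ∀ m n x y → m * n * (x * y) ≡ m * x * (n * y)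
  eq = solve-∀

-- An array of dimension `e + 1` is a family of lines over all of `Vec ℕ e`, with the tuple
-- direction as last argument. The size `n` enters only in the count, so one array can be measured
-- at several sizes.
total : (Vec ℕ e → ℕ → Bool) → ℕ → ℕ
total {e} A n = ∑[ y ∈ box e n ] count (A y) n

total-mono : ∀ (A : Vec ℕ e → ℕ → Bool) {m n} → m ≤ n → total A m ≤ total A n
total-mono {e} A {m} {n} m≤n = ≤-trans (∑-mono (box e m) λ {y} _ → count-mono (A y) m≤n)
                                       (∑-box-mono e (λ y → count (A y) n) m≤n)

-- Carries a bound known at powers of `s` over to every positive size, at the cost of a factor `s`
-- in the size.
next-power : ∀ s → 2 ≤ s → ∀ n → ∃[ i ] (suc n ≤ s ^ i × s ^ i ≤ s * suc n)
next-power s 2≤s zero = 0 , ≤-refl , ≤-trans (<⇒≤ 2≤s) (≤-reflexive (sym (*-identityʳ s)))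
next-power s 2≤s (suc n) with i , n<sⁱ , sⁱ≤ ← next-power s 2≤s n | suc (suc n) ≤? s ^ i
... | yes n+1<sⁱ = i , n+1<sⁱ , ≤-trans sⁱ≤ (*-monoʳ-≤ s (n≤1+n (suc n)))
... | no  n+1≮sⁱ with ≤-antisym n<sⁱ (s≤s⁻¹ (≰⇒> n+1≮sⁱ))
...   | eq = suc i , grows , *-monoʳ-≤ s (≤-trans (≤-reflexive (sym eq)) (n≤1+n (suc n)))
  where
  open ≤-Reasoning
  grows : suc (suc n) ≤ s * s ^ i
  grows = begin
    suc (suc n)
      ≤⟨ s≤s (≤-trans (≤-reflexive (sym (+-identityʳ (suc n)))) (m≤n+m (suc n + 0) n)) ⟩
    2 * suc n            ≤⟨ *-monoˡ-≤ (suc n) 2≤s ⟩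
    s * suc n            ≡⟨ cong (s *_) eq ⟩
    s * s ^ i            ∎

-- The relaxed form of containment carried through the induction: the j ones
-- replacing a point are only asked to lie in a window of its line, the windows
-- being disjoint and ordered as the pattern prescribes.  The points of the
-- pattern are indexed by an arbitrary I, with coordinates p and q; no coordinate
-- needs to be sorted when another one is deleted.

record Config {I : Set} (j : ℕ) (p : I → Fin e → ℕ) (q : I → ℕ) (A : Vec ℕ e → ℕ → Bool) : Set where
  field
    line       : I → Vec ℕ e
    start stop : I → ℕ
    line-<     : ∀ {i i′} ℓ → p i ℓ < p i′ ℓ → lookup (line i) ℓ < lookup (line i′) ℓ
    stop≤start : ∀ {i i′} → q i < q i′ → stop i ≤ start i′
    dense      : ∀ i → j + count (A (line i)) (start i) ≤ count (A (line i)) (stop i)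

open Config

-- The bound for the relaxed containment: statement and one-dimensional case.

module _ (k : ℕ) where

  -- `C` is chosen before the pattern, so it depends on `k`, `e` and `j` alone. Uniformity in `p`
  -- and `q` permits the induction to delete any coordinate and to let another one take the role of
  -- `q`.
  Bounded : ℕ → ℕ → Set₁
  Bounded e j = ∃[ C ] ∀ {I : Set} (p : I → Fin e → ℕ) (q : I → ℕ) → (∀ i ℓ → p i ℓ < k) →
      (∀ i → q i < k) →
    ∀ (A : Vec ℕ e → ℕ → Bool) → ¬ Config j p q A → ∀ n → total A n ≤ C * n ^ e

  -- More than `k * suc j` ones on a line contain `k` consecutive groups of `suc j` ones; the point
  -- `i` receives the group with number `q i`.
  bounded-line : ∀ j → Bounded 0 (suc j)
  bounded-line j = k * suc j , bound
    where
    bound : ∀ {I : Set} (p : I → Fin 0 → ℕ) (q : I → ℕ) → _ → (∀ i → q i < k) →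
      ∀ (A : Vec ℕ 0 → ℕ → Bool) → ¬ Config (suc j) p q A → ∀ n → total A n ≤ k * suc j * n ^ 0
    bound {I} p q _ q<k A avoids n with count (A []) n ≤? k * suc j
    ... | yes few = ≤-trans (≤-reflexive (+-identityʳ _))
        (≤-trans few (≤-reflexive (sym (*-identityʳ _))))
    ... | no  many = contradiction record
        { line       = λ _ → []
        ; start      = proj₁ ∘ first
        ; stop       = suc ∘ proj₁ ∘ last
        ; line-<     = λ ()
        ; stop≤start = λ {i} {i′} qi<qi′ → count-cancel-< (A [])
            (subst₂ _<_ (sym (proj₂ (proj₂ (proj₂ (last i)))))
                (sym (proj₂ (proj₂ (proj₂ (first i′))))) (earlier qi<qi′))
        ; dense      = λ i → ≤-reflexive (trans (cong (suc j +_) (proj₂ (proj₂ (proj₂ (first i)))))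
            (sym (trans (count-suc (A []) (proj₁ (proj₂ (proj₂ (last i)))))
                (cong suc (proj₂ (proj₂ (proj₂ (last i))))))))
        } avoids
      where
      earlier : ∀ {x y} → x < y → j + x * suc j < y * suc j
      earlier = *-monoˡ-≤ (suc j)

      first : ∀ i → ∃[ x ] (x < n × T (A [] x) × count (A []) x ≡ q i * suc j)
      first i = nth (A []) {n = n} (<-trans (≤-<-trans (m≤n+m _ j) (earlier (q<k i))) (≰⇒> many))

      last : ∀ i → ∃[ x ] (x < n × T (A [] x) × count (A []) x ≡ j + q i * suc j)
      last i = nth (A []) {n = n} (<-trans (earlier (q<k i)) (≰⇒> many))

  -- The three summands pay for the unclosed intervals, the blocks with more than `k` marks and the
  -- wide marks.
  remainderConstant : (e j s C C′ : ℕ) → ℕ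
  remainderConstant e j s C C′ =
    j + j * (k ^ suc e * (s * (length (tuples (suc k) (downFrom s)) * C))
             + s ^ suc e * (length (allFin (suc e)) * (length (tuples k (box (suc e) s)) * C′)))

  -- One contraction step, from an array to its blocks of side `s`.

  module Contraction
    (e j s N : ℕ) (1≤j : 1 ≤ j) {I : Set}
    (p : I → Fin (suc e) → ℕ) (q : I → ℕ) (p<k : ∀ i ℓ → p i ℓ < k) (q<k : ∀ i → q i < k)
    (A : Vec ℕ (suc e) → ℕ → Bool) (avoids : ¬ Config j p q A)
    where

    offsets : List (Vec ℕ (suc e))
    offsets = box (suc e) s

    module Strip (Y : Vec ℕ (suc e)) = Scan offsets (λ o → A (place s Y o)) j

    blockMarks : Vec ℕ (suc e) → ℕ → ℕ → Bool
    blockMarks Y X r = Strip.mark Y (r + X * s)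

    contracted : Vec ℕ (suc e) → ℕ → Bool
    contracted Y X = ⌊ 1 ≤? count (blockMarks Y X) s ⌋

    contracted⇒mark : ∀ {Y X} → T (contracted Y X) → ∃[ r ] (r < s × T (blockMarks Y X r))
    contracted⇒mark {Y} {X} h
      with r , r<s , m , _ ← nth (blockMarks Y X)
          (toWitness {a? = 1 ≤? count (blockMarks Y X) s} h) = r , r<s , m

    -- The line supplied by `between-marks` varies with the point of the pattern. This does no harm:
    -- points that must be ordered in a coordinate lie in different blocks of that coordinate,
    -- whatever their offsets.
    contracted-avoids : ¬ Config 2 p q contracted
    contracted-avoids K = avoids record
      { line       = λ i → place s (line K i) (offset i)
      ; start      = λ i → start K i * s
      ; stop       = λ i → stop K i * s
      ; line-<     = λ {i} {i′} ℓ pi<pi′ →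
          place-< s (line K i) (line K i′) (offset i) (offset i′) ℓ
            (∈-box⁻ (suc e) s (offset∈ i) ℓ) (line-< K ℓ pi<pi′)
      ; stop≤start = λ qi<qi′ → *-monoˡ-≤ s (stop≤start K qi<qi′)
      ; dense      = denseˢ
      }
      where
      window : ∀ i → ∃[ o ] (o ∈ offsets ×
        j + count (A (place s (line K i) o)) (start K i * s) ≤
            count (A (place s (line K i) o)) (stop K i * s))
      window i =
        -- Two blocks of the window that contain marks; the ones enclosed by these marks stay inside
        -- the window scaled by `s`.
        let X , u≤X , _ , QX , cX       = nth-from (contracted (line K i)) {0}
                (≤-trans (n≤1+n _) (dense K i))
            X′ , _ , X′<v , QX′ , cX′   = nth-from (contracted (line K i)) {1} (dense K i)
            r , r<s , m                 = contracted⇒mark {line K i} {X} QX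
            r′ , r′<s , m′              = contracted⇒mark {line K i} {X′} QX′
            X<X′                        = count-cancel-< (contracted (line K i))
                (subst₂ _<_ (sym cX) (sym cX′) (n<1+n _))
            o , o∈ , h                  = Strip.between-marks (line K i) m m′
                (remainder-< r′ r<s X<X′)
            a                           = A (place s (line K i) o)
        in o , o∈ ,
           ≤-trans (+-monoʳ-≤ j (count-mono a
               (≤-trans (*-monoˡ-≤ s u≤X) (≤-trans (m≤n+m (X * s) r) (n≤1+n _)))))
                   (≤-trans h (count-mono a (remainder-< 0 r′<s X′<v)))

      offset : I → Vec ℕ (suc e)
      offset = proj₁ ∘ window

      offset∈ : ∀ i → offset i ∈ offsets
      offset∈ = proj₁ ∘ proj₂ ∘ window

      denseˢ : ∀ i → _
      denseˢ = proj₂ ∘ proj₂ ∘ window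

    -- The scan direction is frozen at block `X`, and the strip coordinate 0, here `Z`, takes its
    -- place as the direction of the lines.
    crowded : ℕ → Vec ℕ (suc k) → Vec ℕ e → ℕ → Bool
    crowded X t Y Z = spread id (blockMarks (Z ∷ Y) X) t

    -- All chosen blocks have their marks at the same positions `t`. The point `i` uses the gap
    -- between the marks with numbers `q i` and `q i + 1`, which encloses `j` ones on one line;
    -- sharing `t` and `X` puts these gaps in the order of `q`.
    crowded-avoids : ∀ X t → ¬ Config 1 (λ i → p i ∘ suc) (λ i → p i zero) (crowded X t)
    crowded-avoids X t K = avoids record
      { line       = λ i → place s (layer i ∷ line K i) (offset i)
      ; start      = λ i → suc (lookup t (lo i) + X * s)
      ; stop       = λ i → suc (lookup t (hi i) + X * s)
      ; line-<     = line-<ˢ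
      ; stop≤start = λ {i} {i′} qi<qi′ → s≤s (+-monoˡ-≤ (X * s)
          (spread-≤ {f = id} {S = blockMarks (layer i ∷ line K i) X} {τ = t} (spreads i)
            (subst₂ _≤_ (sym (toℕ-fromℕ< (s≤s (q<k i))))
                        (sym (toℕ-fromℕ< (m<n⇒m<1+n (q<k i′)))) qi<qi′)))
      ; dense      = λ i → proj₂ (proj₂ (window i))
      }
      where
      layers : ∀ i → ∃[ Z ] (start K i ≤ Z × Z < stop K i × T (crowded X t (line K i) Z) × _)
      layers i = nth-from (crowded X t (line K i)) {0} (dense K i)

      layer : I → ℕ
      layer = proj₁ ∘ layers

      layer-< : ∀ {i i′} → p i zero < p i′ zero → layer i < layer i′
      layer-< {i} {i′} h = <-≤-trans (proj₁ (proj₂ (proj₂ (layers i))))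
          (≤-trans (stop≤start K h) (proj₁ (proj₂ (layers i′))))

      spreads : ∀ i → Spread id (blockMarks (layer i ∷ line K i) X) t
      spreads i = spread⇒Spread {f = id} {blockMarks (layer i ∷ line K i) X} {t}
          (proj₁ (proj₂ (proj₂ (proj₂ (layers i)))))

      -- The `k + 1` marks leave `k` gaps, one for each value of `q`.
      lo hi : I → Fin (suc k)
      lo i = fromℕ< (m<n⇒m<1+n (q<k i))
      hi i = fromℕ< (s≤s (q<k i))

      window : ∀ i → ∃[ o ] (o ∈ offsets ×
        j + count (A (place s (layer i ∷ line K i) o)) (suc (lookup t (lo i) + X * s)) ≤
            count (A (place s (layer i ∷ line K i) o)) (suc (lookup t (hi i) + X * s)))
      window i = Strip.between-marks (layer i ∷ line K i) (proj₂ (spreads i) (lo i))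
          (proj₂ (spreads i) (hi i))
        (+-monoˡ-< (X * s) (proj₁ (spreads i) (lo i) (hi i)
          (subst₂ _<_ (sym (toℕ-fromℕ< (m<n⇒m<1+n (q<k i)))) (sym (toℕ-fromℕ< (s≤s (q<k i))))
              (n<1+n _))))

      offset : I → Vec ℕ (suc e)
      offset = proj₁ ∘ window

      offset∈ : ∀ i → offset i ∈ offsets
      offset∈ = proj₁ ∘ proj₂ ∘ window

      line-<ˢ : ∀ {i i′} ℓ → p i ℓ < p i′ ℓ →
        lookup (place s (layer i ∷ line K i) (offset i)) ℓ <
        lookup (place s (layer i′ ∷ line K i′) (offset i′)) ℓ
      line-<ˢ {i} {i′} ℓ pi<pi′ =
        place-< s (layer i ∷ line K i) (layer i′ ∷ line K i′) (offset i) (offset i′) ℓ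
          (∈-box⁻ (suc e) s (offset∈ i) ℓ) (coordinate ℓ pi<pi′)
        where
        coordinate : ∀ ℓ → p i ℓ < p i′ ℓ →
          lookup (layer i ∷ line K i) ℓ < lookup (layer i′ ∷ line K i′) ℓ
        coordinate zero    = layer-<
        coordinate (suc ℓ) = line-< K ℓ

    wideAt : Fin (suc e) → Vec (Vec ℕ (suc e)) k → Vec ℕ (suc e) → ℕ → Bool
    wideAt ℓ τ Y x = Strip.mark Y x ∧ spread (λ o → lookup o ℓ) (λ o → Strip.active Y o x) τ

    wide : Fin (suc e) → Vec (Vec ℕ (suc e)) k → ℕ → Vec ℕ e → ℕ → Bool
    wide ℓ τ z Y = wideAt ℓ τ (insertAt Y ℓ z)

    wideAt⇒ : ∀ {ℓ τ Y x} → T (wideAt ℓ τ Y x) →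
      T (Strip.mark Y x) × Spread (λ o → lookup o ℓ) (λ o → Strip.active Y o x) τ
    wideAt⇒ {ℓ} {τ} {Y} {x} h with m , sp ← Equivalence.to T-∧ h =
      m , spread⇒Spread {f = λ o → lookup o ℓ} {λ o → Strip.active Y o x} {τ} sp

    -- The point `i` goes to the line of `τ` with number `p i ℓ`, so the spread of `τ` restores the
    -- order in the deleted coordinate `ℓ`; the other coordinates are ordered by blocks. Windows are
    -- kept, and `active-marks` turns `suc j` marks into `j` ones on that line.
    wide-avoids : ∀ ℓ {τ} → τ ∈ tuples k offsets → ∀ z →
        ¬ Config (suc j) (λ i → p i ∘ punchIn ℓ) q (wide ℓ τ z)
    wide-avoids ℓ {τ} τ∈ z K = avoids record
      { line       = λ i → place s (layer i) (offset i)
      ; start      = start K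
      ; stop       = stop K
      ; line-<     = λ ℓ′ → line-<ˢ ℓ′
      ; stop≤start = stop≤start K
      ; dense      = λ i → Strip.active-marks (layer i) (offset i) (wide ℓ τ z (line K i))
          (λ {x} h → let m , sp = wideAt⇒ {ℓ} {τ} {layer i} {x} h in m , proj₂ sp (rank i))
          j (dense K i)
      }
      where
      layer : I → Vec ℕ (suc e)
      layer i = insertAt (line K i) ℓ z

      rank : I → Fin k
      rank i = fromℕ< (p<k i ℓ)

      offset : I → Vec ℕ (suc e)
      offset i = lookup τ (rank i)

      -- A dense window contains at least one wide mark, which certifies that `τ` increases strictly
      -- in coordinate `ℓ`.
      some-spread : ∀ i → ∃[ x ] Spread (λ o → lookup o ℓ) (λ o → Strip.active (layer i) o x) τ
      some-spread i with x , _ , _ , h , _ ← nth-from (wide ℓ τ z (line K i)) {0}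
          (≤-trans (s≤s (m≤n+m _ j)) (dense K i)) =
        x , proj₂ (wideAt⇒ {ℓ} {τ} {layer i} {x} h)

      line-<ˢ : ∀ {i i′} ℓ′ → p i ℓ′ < p i′ ℓ′ →
          lookup (place s (layer i) (offset i)) ℓ′ < lookup (place s (layer i′) (offset i′)) ℓ′
      line-<ˢ {i} {i′} ℓ′ lt with ℓ Fin.≟ ℓ′
      ... | yes refl = subst₂ _<_ (sym (at i)) (sym (at i′)) (+-monoˡ-< (z * s)
              (proj₁ (proj₂ (some-spread i)) (rank i) (rank i′)
                  (subst₂ _<_ (sym (toℕ-fromℕ< (p<k i ℓ))) (sym (toℕ-fromℕ< (p<k i′ ℓ))) lt)))
        where
        at : ∀ i → lookup (place s (layer i) (offset i)) ℓ ≡ lookup (offset i) ℓ + z * s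
        at i = trans (lookup-place s (layer i) (offset i) ℓ)
            (cong (λ v → lookup (offset i) ℓ + v * s) (insertAt-lookup (line K i) ℓ z))
      ... | no ℓ≢ℓ′ = place-< s (layer i) (layer i′) (offset i) (offset i′) ℓ′
          (∈-box⁻ (suc e) s (∈-tuples⁻ τ∈ (rank i)) ℓ′)
              (subst₂ _<_ (sym (at i)) (sym (at i′))
                  (line-< K m (subst₂ _<_ (cong (p i) (sym pm)) (cong (p i′) (sym pm)) lt)))
        where
        m = punchOut ℓ≢ℓ′
        pm : punchIn ℓ m ≡ ℓ′
        pm = punchIn-punchOut ℓ≢ℓ′
        at : ∀ i → lookup (layer i) ℓ′ ≡ lookup (line K i) m
        at i = trans (cong (lookup (layer i)) (sym pm)) (insertAt-punchIn (line K i) ℓ z m)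

    ∑-wideAt≤ : ∀ {C} → (∀ ℓ {τ} → τ ∈ tuples k offsets → ∀ z →
        total (wide ℓ τ z) (N * s) ≤ C * (N * s) ^ e) →
      1 ≤ s →
      ∑[ Y ∈ box (suc e) N ] ∑[ x ∈ downFrom (N * s) ]
        ∑[ ℓ ∈ allFin (suc e) ] ∑[ τ ∈ tuples k offsets ] ⟦ wideAt ℓ τ Y x ⟧
      ≤ length (allFin (suc e)) * (length (tuples k offsets) * (N * (C * (N * s) ^ e)))
    ∑-wideAt≤ {C} bound 1≤s = begin
      ∑ Ys (λ Y → ∑ xs (λ x → ∑ ℓs (λ ℓ → ∑ τs (λ τ → ⟦ wideAt ℓ τ Y x ⟧))))
        ≡⟨ ∑-cong Ys (λ Y → ∑-swap₃ xs ℓs τs _) ⟩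
      ∑ Ys (λ Y → ∑ ℓs (λ ℓ → ∑ τs (λ τ → ∑ xs (λ x → ⟦ wideAt ℓ τ Y x ⟧))))
        ≡⟨ ∑-swap₃ Ys ℓs τs _ ⟩
      ∑ ℓs (λ ℓ → ∑ τs (λ τ → ∑ Ys (λ Y → ∑ xs (λ x → ⟦ wideAt ℓ τ Y x ⟧))))
        ≤⟨ ∑-≤-const ℓs (λ {ℓ} _ → ∑-≤-const τs (λ {τ} τ∈ → layers ℓ τ τ∈)) ⟩
      length ℓs * (length τs * (N * (C * (N * s) ^ e))) ∎
      where
      open ≤-Reasoning
      Ys = box (suc e) N
      xs = downFrom (N * s)
      ℓs = allFin (suc e)
      τs = tuples k offsets

      N≤Ns : N ≤ N * s
      N≤Ns = ≤-trans (≤-reflexive (sym (*-identityʳ N))) (*-monoʳ-≤ N 1≤s)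

      layers : ∀ ℓ τ → τ ∈ τs → ∑ Ys (λ Y → ∑ xs (λ x → ⟦ wideAt ℓ τ Y x ⟧)) ≤ N * (C * (N * s) ^ e)
      layers ℓ τ τ∈ = begin
        ∑ Ys (λ Y → ∑ xs (λ x → ⟦ wideAt ℓ τ Y x ⟧))
          ≡⟨ ∑-cong Ys (λ Y → sym (count≡∑ (wideAt ℓ τ Y) (N * s))) ⟩
        ∑ Ys (λ Y → count (wideAt ℓ τ Y) (N * s))
          ≡⟨ ∑-tuples-insertAt e (downFrom N) ℓ _ ⟩
        ∑ (downFrom N) (λ z → ∑ (box e N) (λ Y → count (wide ℓ τ z Y) (N * s)))
          -- The strip coordinates run to `N` but the scan coordinate to `N * s`; enlarging the
          -- former gives a cube, to which `bound` applies in each of the `N` slabs.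
          ≤⟨ ∑-≤-const (downFrom N) (λ {z} _ → ≤-trans (∑-box-mono e _ N≤Ns) (bound ℓ τ∈ z)) ⟩
        length (downFrom N) * (C * (N * s) ^ e)
          ≡⟨ cong (_* (C * (N * s) ^ e)) (length-downFrom N) ⟩
        N * (C * (N * s) ^ e) ∎

    -- Apply `count-≤-spread` in every block: blocks with a mark are the ones of `contracted`, and
    -- increasing tuples of `k + 1` marks are the ones of the arrays `crowded X t`.
    ∑-marks≤ : ∀ {C} → (∀ X t → total (crowded X t) N ≤ C * N ^ e) →
      ∑[ Y ∈ box (suc e) N ] ∑[ x ∈ downFrom (N * s) ] ⟦ Strip.mark Y x ⟧
      ≤ k * total contracted N + s * (N * (length (tuples (suc k) (downFrom s)) * (C * N ^ e)))
    ∑-marks≤ {C} bound = begin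
      ∑ Ys (λ Y → ∑ (downFrom (N * s)) (λ x → ⟦ Strip.mark Y x ⟧))
        ≡⟨ ∑-cong Ys (λ Y → trans (∑-downFrom-* N s _)
            (∑-cong Xs λ X → sym (count≡∑ (blockMarks Y X) s))) ⟩
      ∑ Ys (λ Y → ∑ Xs (λ X → count (blockMarks Y X) s))
        ≤⟨ ∑-mono Ys (λ {Y} _ → ∑-mono Xs (λ {X} _ → count-≤-spread k (blockMarks Y X) s)) ⟩
      ∑ Ys (λ Y → ∑ Xs (λ X → k * ⟦ contracted Y X ⟧
        + s * ∑ ts (λ t → ⟦ spread id (blockMarks Y X) t ⟧)))
        ≡⟨ ∑-cong Ys (λ Y → ∑-linear Xs k s _ _) ⟩
      ∑ Ys (λ Y → k * ∑ Xs (λ X → ⟦ contracted Y X ⟧)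
        + s * ∑ Xs (λ X → ∑ ts (λ t → ⟦ spread id (blockMarks Y X) t ⟧)))
        ≡⟨ ∑-linear Ys k s _ _ ⟩
      k * ∑ Ys (λ Y → ∑ Xs (λ X → ⟦ contracted Y X ⟧))
        + s * ∑ Ys (λ Y → ∑ Xs (λ X → ∑ ts (λ t → ⟦ spread id (blockMarks Y X) t ⟧)))
        ≤⟨ +-mono-≤ (*-monoʳ-≤ k (≤-reflexive (∑-cong Ys λ Y → sym (count≡∑ (contracted Y) N))))
            (*-monoʳ-≤ s crowdedBlocks) ⟩
      k * total contracted N + s * (N * (length ts * (C * N ^ e))) ∎
      where
      open ≤-Reasoning
      Ys = box (suc e) N
      Xs = downFrom N
      ts = tuples (suc k) (downFrom s)

      columns : ∀ X t → ∑ Ys (λ Y → ⟦ spread id (blockMarks Y X) t ⟧) ≤ C * N ^ e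
      columns X t = begin
        ∑ Ys (λ Y → ⟦ spread id (blockMarks Y X) t ⟧)
          ≡⟨ ∑-tuples e Xs _ ⟩
        ∑ Xs (λ Z → ∑ (box e N) (λ Y → ⟦ crowded X t Y Z ⟧))
          ≡⟨ ∑-swap Xs (box e N) _ ⟩
        ∑ (box e N) (λ Y → ∑ Xs (λ Z → ⟦ crowded X t Y Z ⟧))
          ≡⟨ ∑-cong (box e N) (λ Y → sym (count≡∑ (crowded X t Y) N)) ⟩
        total (crowded X t) N
          ≤⟨ bound X t ⟩
        C * N ^ e ∎

      crowdedBlocks : ∑ Ys (λ Y → ∑ Xs (λ X → ∑ ts (λ t → ⟦ spread id (blockMarks Y X) t ⟧)))
        ≤ N * (length ts * (C * N ^ e))
      crowdedBlocks = begin
        ∑ Ys (λ Y → ∑ Xs (λ X → ∑ ts (λ t → ⟦ spread id (blockMarks Y X) t ⟧)))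
          ≡⟨ ∑-swap₃ Ys Xs ts _ ⟩
        ∑ Xs (λ X → ∑ ts (λ t → ∑ Ys (λ Y → ⟦ spread id (blockMarks Y X) t ⟧)))
          ≤⟨ ∑-≤-const Xs (λ {X} _ → ∑-≤-const ts (λ {t} _ → columns X t)) ⟩
        length Xs * (length ts * (C * N ^ e))
          ≡⟨ cong (_* (length ts * (C * N ^ e))) (length-downFrom N) ⟩
        N * (length ts * (C * N ^ e)) ∎

    -- Each mark is charged `j` ones per active line, and `∑-box-≤-spread` replaces the number of
    -- active lines by `k ^ suc e` plus a multiple of the number of types for which the mark is
    -- wide.
    total≤ : total A (N * s) ≤
      N ^ suc e * (j * s ^ suc e)
      + j * (k ^ suc e * ∑[ Y ∈ box (suc e) N ] ∑[ x ∈ downFrom (N * s) ] ⟦ Strip.mark Y x ⟧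
             + s ^ suc e * ∑[ Y ∈ box (suc e) N ] ∑[ x ∈ downFrom (N * s) ]
                           ∑[ ℓ ∈ allFin (suc e) ] ∑[ τ ∈ tuples k offsets ] ⟦ wideAt ℓ τ Y x ⟧)
    total≤ = begin
      total A (N * s)
        ≡⟨ ∑-box-blocks (suc e) N s (λ y → count (A y) (N * s)) ⟩
      ∑ Ys (λ Y → ∑ offsets (λ o → count (A (place s Y o)) (N * s)))
        ≤⟨ ∑-mono Ys (λ {Y} _ → strip Y) ⟩
      ∑ Ys (λ Y → j * s ^ suc e + j * ∑ xs (λ x → k ^ suc e * M Y x + s ^ suc e * G Y x))
        ≡⟨ ∑-+ Ys _ _ ⟩
      ∑ Ys (λ Y → j * s ^ suc e)
        + ∑ Ys (λ Y → j * ∑ xs (λ x → k ^ suc e * M Y x + s ^ suc e * G Y x))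
        ≡⟨ cong₂ _+_ (trans (∑-const Ys _) (cong (_* (j * s ^ suc e)) (length-box (suc e) N)))
             (trans (∑-*ˡ Ys j _) (cong (j *_)
                 (trans (∑-cong Ys λ Y → ∑-linear xs (k ^ suc e) (s ^ suc e) (M Y) (G Y))
                 (∑-linear Ys (k ^ suc e) (s ^ suc e) (λ Y → ∑ xs (M Y)) (λ Y → ∑ xs (G Y)))))) ⟩
      _ ∎
      where
      open ≤-Reasoning
      Ys = box (suc e) N
      xs = downFrom (N * s)

      M G : Vec ℕ (suc e) → ℕ → ℕ
      M Y x = ⟦ Strip.mark Y x ⟧
      G Y x = ∑ (allFin (suc e)) (λ ℓ → ∑ (tuples k offsets) (λ τ → ⟦ wideAt ℓ τ Y x ⟧))

      distribute : ∀ b {r} K L (h : Fin (suc e) → Vec (Vec ℕ (suc e)) k → Bool) →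
        r ≤ K + L * ∑ (allFin (suc e)) (λ ℓ → ∑ (tuples k offsets) (λ τ → ⟦ h ℓ τ ⟧)) →
        ⟦ b ⟧ * r ≤ K * ⟦ b ⟧
          + L * ∑ (allFin (suc e)) (λ ℓ → ∑ (tuples k offsets) (λ τ → ⟦ b ∧ h ℓ τ ⟧))
      distribute false K L h r≤ = z≤n
      distribute true {r} K L h r≤ = ≤-trans (≤-reflexive (*-identityˡ r))
        (≤-trans r≤ (+-monoˡ-≤ _ (≤-reflexive (sym (*-identityʳ K)))))

      strip : ∀ Y → ∑ offsets (λ o → count (A (place s Y o)) (N * s)) ≤
                    j * s ^ suc e + j * ∑ xs (λ x → k ^ suc e * M Y x + s ^ suc e * G Y x)
      strip Y = begin
        ∑ offsets (λ o → count (A (place s Y o)) (N * s))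
          ≤⟨ Strip.∑-count≤ Y 1≤j (N * s) ⟩
        j * length offsets + j * ∑ xs (λ x → M Y x * ∑ offsets (λ o → ⟦ Strip.active Y o x ⟧))
          ≤⟨ +-mono-≤ (*-monoʳ-≤ j (≤-reflexive (length-box (suc e) s)))
               (*-monoʳ-≤ j (∑-mono xs λ {x} _ → distribute (Strip.mark Y x) (k ^ suc e) (s ^ suc e)
                  (λ ℓ τ → spread (λ o → lookup o ℓ) (λ o → Strip.active Y o x) τ)
                  (∑-box-≤-spread k (suc e) s (λ o → Strip.active Y o x)))) ⟩
        j * s ^ suc e + j * ∑ xs (λ x → k ^ suc e * M Y x + s ^ suc e * G Y x) ∎

    contraction : ∀ {C C′} → 1 ≤ s → (∀ X t → total (crowded X t) N ≤ C * N ^ e) →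
      (∀ ℓ {τ} → τ ∈ tuples k offsets → ∀ z → total (wide ℓ τ z) (N * s) ≤ C′ * (N * s) ^ e) →
      total A (N * s) ≤
      j * k ^ suc e * k * total contracted N + remainderConstant e j s C C′ * (N * s) ^ suc e
    contraction {C} {C′} 1≤s crowded≤ wide≤ = begin
      total A (N * s)
        ≤⟨ total≤ ⟩
      N ^ suc e * (j * s ^ suc e) + j * (k ^ suc e * _ + s ^ suc e * _)
        ≤⟨ +-monoʳ-≤ (N ^ suc e * (j * s ^ suc e)) (*-monoʳ-≤ j (+-mono-≤
             (*-monoʳ-≤ (k ^ suc e) (∑-marks≤ {C} crowded≤))
             (*-monoʳ-≤ (s ^ suc e) (∑-wideAt≤ {C′} wide≤ 1≤s)))) ⟩
      N ^ suc e * (j * s ^ suc e)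
        + j * (k ^ suc e * (k * Q + s * (N * (t * (C * N ^ e))))
               + s ^ suc e * (l * (τ * (N * (C′ * D ^ e)))))
        ≡⟨ eq₁ N (N ^ e) (s ^ suc e) (k ^ suc e) (D ^ e) j k s Q t C l τ C′ ⟩
      j * k ^ suc e * k * Q + (j * (N ^ suc e * s ^ suc e)
        + j * (k ^ suc e * (s * (t * C)) * (N * N ^ e) + s ^ suc e * (l * (τ * C′)) * (N * D ^ e)))
        ≤⟨ +-monoʳ-≤ (j * k ^ suc e * k * Q)
            (+-mono-≤ (*-monoʳ-≤ j (≤-reflexive (sym (^-distribʳ-* (suc e) N s))))
             (*-monoʳ-≤ j (+-mono-≤ (*-monoʳ-≤ (k ^ suc e * (s * (t * C))) (^-monoˡ-≤ (suc e) N≤D))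
                                    (*-monoʳ-≤ (s ^ suc e * (l * (τ * C′)))
                                        (*-monoˡ-≤ (D ^ e) N≤D))))) ⟩
      j * k ^ suc e * k * Q + (j * D ^ suc e
        + j * (k ^ suc e * (s * (t * C)) * D ^ suc e + s ^ suc e * (l * (τ * C′)) * D ^ suc e))
        ≡⟨ eq₂ (j * k ^ suc e * k * Q) (D ^ suc e) (k ^ suc e * (s * (t * C)))
            (s ^ suc e * (l * (τ * C′))) j ⟩
      j * k ^ suc e * k * Q + remainderConstant e j s C C′ * D ^ suc e ∎
      where
      open ≤-Reasoning
      Q = total contracted N
      D = N * s
      t = length (tuples (suc k) (downFrom s))
      l = length (allFin (suc e))
      τ = length (tuples k offsets)

      N≤D : N ≤ D
      N≤D = ≤-trans (≤-reflexive (sym (*-identityʳ N))) (*-monoʳ-≤ N 1≤s)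

      eq₁ : ∀ N Nᵉ S K Dᵉ j k s Q t C l τ C′ →
        N * Nᵉ * (j * S)
          + j * (K * (k * Q + s * (N * (t * (C * Nᵉ)))) + S * (l * (τ * (N * (C′ * Dᵉ))))) ≡
        j * K * k * Q + (j * (N * Nᵉ * S)
          + j * (K * (s * (t * C)) * (N * Nᵉ) + S * (l * (τ * C′)) * (N * Dᵉ)))
      eq₁ = solve-∀

      eq₂ : ∀ x D a b j → x + (j * D + j * (a * D + b * D)) ≡ x + (j + j * (a + b)) * D
      eq₂ = solve-∀

  -- Solving the recursion and the induction on the dimension.

  Contracts : (e j s β c : ℕ) → Set₁
  Contracts e j s β c =
    ∀ {I : Set} (p : I → Fin (suc e) → ℕ) (q : I → ℕ) → (∀ i ℓ → p i ℓ < k) → (∀ i → q i < k) →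
      ∀ (A : Vec ℕ (suc e) → ℕ → Bool) → ¬ Config j p q A → ∀ N →
      ∃[ B ] ¬ Config 2 p q B × total A (N * s) ≤ β * total B N + c * (N * s) ^ suc e

  -- The factor in front of `total B N` is independent of `s`, so `s` may be chosen afterwards to
  -- exceed it. Crowded blocks call for `Bounded e 1`, wide marks for `Bounded e (suc j)`.
  contracts : ∀ e j s → 1 ≤ j → 1 ≤ s → Bounded e 1 → Bounded e (suc j) →
    ∃[ c ] Contracts e j s (j * k ^ suc e * k) c
  contracts e j s 1≤j 1≤s (C , bounded) (C′ , bounded′) =
    remainderConstant e j s C C′ , λ p q p<k q<k A avoids N →
      let open Contraction e j s N 1≤j p q p<k q<k A avoids in
      contracted , contracted-avoids ,
      contraction {C} {C′} 1≤s
        (λ X t → bounded _ _ (λ i ℓ → p<k i (suc ℓ)) (λ i → p<k i zero) (crowded X t)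
            (crowded-avoids X t) N)
        (λ ℓ {τ} τ∈ z → bounded′ _ _ (λ i ℓ′ → p<k i (punchIn ℓ ℓ′)) q<k (wide ℓ τ z)
            (wide-avoids ℓ τ∈ z) (N * s))

  -- Induction over the powers of `s`. Since `2 * β ≤ s ≤ s ^ suc e`, one half of `C = 2 * suc c`
  -- absorbs the recursive term and the other half the error `c`. Other sizes are rounded up by
  -- `next-power`.
  bounded-pairs-of-contracts : ∀ e s β c → 2 ≤ s → 2 * β ≤ s → Contracts e 2 s β c →
      Bounded (suc e) 2
  bounded-pairs-of-contracts e s β c 2≤s 2β≤s step = C * s ^ suc e , bound
    where
    C : ℕ
    C = 2 * suc c

    instance
      s≢0 : NonZero s
      s≢0 = >-nonZero (<⇒≤ 2≤s)

    module _ {I : Set} (p : I → Fin (suc e) → ℕ) (q : I → ℕ) (p<k : ∀ i ℓ → p i ℓ < k)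
        (q<k : ∀ i → q i < k) where
      open ≤-Reasoning

      at-powers : ∀ i (A : Vec ℕ (suc e) → ℕ → Bool) → ¬ Config 2 p q A →
          total A (s ^ i) ≤ C * (s ^ i) ^ suc e
      at-powers zero A _ = begin
        total A 1                    ≤⟨ ∑-≤-const (box (suc e) 1) (λ {y} _ → count≤ (A y) 1) ⟩
        length (box (suc e) 1) * 1   ≡⟨ trans (*-identityʳ _) (length-box (suc e) 1) ⟩
        1 ^ suc e                    ≤⟨ m≤m+n (1 ^ suc e) _ ⟩
        C * 1 ^ suc e                ∎
      at-powers (suc i) A avoids with B , B-avoids , total≤ ← step p q p<k q<k A avoids
          (s ^ i) = begin
        total A (s ^ suc i)                        ≡⟨ cong (total A) (*-comm s (s ^ i)) ⟩
        total A (s ^ i * s)                        ≤⟨ total≤ ⟩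
        β * total B (s ^ i) + c * D
          ≤⟨ +-monoˡ-≤ (c * D) (*-monoʳ-≤ β (at-powers i B B-avoids)) ⟩
        β * (C * x) + c * D                        ≡⟨ cong (_+ c * D) (eq β c x) ⟩
        suc c * (x * (2 * β)) + c * D
          ≤⟨ +-mono-≤ (*-monoʳ-≤ (suc c) 2βx≤D) (*-monoˡ-≤ D (n≤1+n c)) ⟩
        suc c * D + suc c * D                      ≡⟨ eq′ (suc c) D ⟩
        C * D
          ≡⟨ cong (λ m → C * m ^ suc e) (*-comm (s ^ i) s) ⟩
        C * (s ^ suc i) ^ suc e                    ∎
        where
        x = (s ^ i) ^ suc e
        D = (s ^ i * s) ^ suc e

        eq : ∀ β c x → β * (2 * suc c * x) ≡ suc c * (x * (2 * β))
        eq = solve-∀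

        eq′ : ∀ c D → c * D + c * D ≡ 2 * c * D
        eq′ = solve-∀

        2βx≤D : x * (2 * β) ≤ D
        2βx≤D = begin
          x * (2 * β)     ≤⟨ *-monoʳ-≤ x 2β≤s ⟩
          x * s           ≡⟨ cong (x *_) (*-identityʳ s) ⟨
          x * (s * 1)     ≤⟨ *-monoʳ-≤ x (*-monoʳ-≤ s (m^n>0 s e)) ⟩
          x * s ^ suc e   ≡⟨ ^-distribʳ-* (suc e) (s ^ i) s ⟨
          D               ∎

      bound : ∀ A → ¬ Config 2 p q A → ∀ n → total A n ≤ C * s ^ suc e * n ^ suc e
      bound A avoids zero    = z≤n
      bound A avoids (suc n) with i , n≤sⁱ , sⁱ≤sn ← next-power s 2≤s n = begin
        total A (suc n)                    ≤⟨ total-mono A n≤sⁱ ⟩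
        total A (s ^ i)                    ≤⟨ at-powers i A avoids ⟩
        C * (s ^ i) ^ suc e                ≤⟨ *-monoʳ-≤ C (^-monoˡ-≤ (suc e) sⁱ≤sn) ⟩
        C * (s * suc n) ^ suc e            ≡⟨ cong (C *_) (^-distribʳ-* (suc e) s (suc n)) ⟩
        C * (s ^ suc e * suc n ^ suc e)    ≡⟨ *-assoc C (s ^ suc e) _ ⟨
        C * s ^ suc e * suc n ^ suc e      ∎

  -- With blocks of side 1 the contracted array has the same size but avoids the pattern for pairs,
  -- so the bound for pairs finishes without iteration.
  bounded-of-contracts : ∀ e j β c → Contracts e j 1 β c → Bounded (suc e) 2 → Bounded (suc e) j
  bounded-of-contracts e j β c step (C , pairs) = β * C + c , bound
    where
    bound : ∀ {I : Set} (p : I → Fin (suc e) → ℕ) (q : I → ℕ) → (∀ i ℓ → p i ℓ < k) →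
        (∀ i → q i < k) →
      ∀ A → ¬ Config j p q A → ∀ n → total A n ≤ (β * C + c) * n ^ suc e
    bound p q p<k q<k A avoids n with B , B-avoids , total≤ ← step p q p<k q<k A avoids n = begin
      total A n                                     ≡⟨ cong (total A) (*-identityʳ n) ⟨
      total A (n * 1)                               ≤⟨ total≤ ⟩
      β * total B n + c * (n * 1) ^ suc e
        ≤⟨ +-monoˡ-≤ (c * (n * 1) ^ suc e) (*-monoʳ-≤ β (pairs p q p<k q<k B B-avoids n)) ⟩
      β * (C * n ^ suc e) + c * (n * 1) ^ suc e
        ≡⟨ cong (λ m → β * (C * n ^ suc e) + c * m ^ suc e) (*-identityʳ n) ⟩
      β * (C * n ^ suc e) + c * n ^ suc e           ≡⟨ eq β C c (n ^ suc e) ⟩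
      (β * C + c) * n ^ suc e                       ∎
      where
      open ≤-Reasoning
      eq : ∀ β C c x → β * (C * x) + c * x ≡ (β * C + c) * x
      eq = solve-∀

  bounded-pairs : ∀ e → Bounded e 1 → Bounded e 3 → Bounded (suc e) 2
  bounded-pairs e bounded₁ bounded₃ =
    -- The side `2 + 2 * β` satisfies both `2 ≤ s` and `2 * β ≤ s`.
    bounded-pairs-of-contracts e (2 + 2 * β) β (proj₁ step) (m≤m+n 2 _) (m≤n+m _ 2) (proj₂ step)
    where
    β : ℕ
    β = 2 * k ^ suc e * k

    step : ∃[ c ] Contracts e 2 (2 + 2 * β) β c
    step = contracts e 2 (2 + 2 * β) (s≤s z≤n) (s≤s z≤n) bounded₁ bounded₃

  -- The step to `suc e` draws on dimension `e` with 1, 3 and `2 + j` ones per window, so the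
  -- induction hypothesis must cover all `j`.
  bounded : ∀ e j → Bounded e (suc j)
  bounded zero    j = bounded-line j
  bounded (suc e) j = bounded-of-contracts e (suc j) (suc j * k ^ suc e * k) (proj₁ step)
      (proj₂ step)
                        (bounded-pairs e (bounded e 0) (bounded e 2))
    where
    step : ∃[ c ] Contracts e (suc j) 1 (suc j * k ^ suc e * k) c
    step = contracts e (suc j) 1 (s≤s z≤n) ≤-refl (bounded e 0) (bounded e (suc j))

-- From matrices with finite index sets to arrays over the natural numbers.

length-filterᵇ : (a : X → Bool) (xs : List X) → length (filterᵇ a xs) ≡ ∑ xs (λ x → ⟦ a x ⟧)
length-filterᵇ a []       = refl
length-filterᵇ a (x ∷ xs) with a x
... | true  = cong suc (length-filterᵇ a xs)
... | false = length-filterᵇ a xs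

-- `downFrom` starts at the top and `allFin` at 0; splitting off the value 0 reconciles the two
-- orders.
∑-downFrom-suc : ∀ n (g : ℕ → ℕ) → ∑ (downFrom (suc n)) g ≡ g 0 + ∑ (downFrom n) (g ∘ suc)
∑-downFrom-suc zero    g = refl
∑-downFrom-suc (suc n) g = trans (cong (g (suc n) +_) (∑-downFrom-suc n g)) (eq (g (suc n)) (g 0) _)
  where
  eq : ∀ a b c → a + (b + c) ≡ b + (a + c)
  eq = solve-∀

∑-tabulate : ∀ n (f : Fin n → X) (h : X → ℕ) (g : ℕ → ℕ) → (∀ i → h (f i) ≡ g (toℕ i)) →
             ∑ (List.tabulate f) h ≡ ∑ (downFrom n) g
∑-tabulate zero    f h g eq = refl
∑-tabulate (suc n) f h g eq =
  trans (cong₂ _+_ (eq zero) (∑-tabulate n (f ∘ suc) h (g ∘ suc) (eq ∘ suc)))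
      (sym (∑-downFrom-suc n g))

extend : ∀ d n → Matrix (replicate d n) → Vec ℕ d → Bool
extend zero    n A []      = A []
extend (suc d) n A (v ∷ z) with v <? n
... | yes v<n = extend d n (λ is → A (fromℕ< v<n ∷ is)) z
... | no  _   = false

extend⇒ : ∀ d n (A : Matrix (replicate d n)) z → T (extend d n A z) →
          ∃[ i ] (T (A i) × ∀ ℓ → toℕ (coord i ℓ) ≡ lookup z ℓ)
extend⇒ zero    n A []      t = [] , t , λ ()
extend⇒ (suc d) n A (v ∷ z) t with v <? n
... | yes v<n with i , Ai , eq ← extend⇒ d n (λ is → A (fromℕ< v<n ∷ is)) z t =
  fromℕ< v<n ∷ i , Ai , λ { zero → toℕ-fromℕ< v<n ; (suc ℓ) → eq ℓ }

∑-extend : ∀ d n (A : Matrix (replicate d n)) →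
           ∑ (indices (replicate d n)) (λ i → ⟦ A i ⟧) ≡ ∑ (box d n) (λ z → ⟦ extend d n A z ⟧)
∑-extend zero    n A = refl
∑-extend (suc d) n A = begin
  ∑ (indices (replicate (suc d) n)) (λ i → ⟦ A i ⟧)
    ≡⟨ ∑-cartesianProductWith _∷_ (allFin n) (indices (replicate d n)) _ ⟩
  ∑ (allFin n) (λ v → ∑ (indices (replicate d n)) (λ is → ⟦ A (v ∷ is) ⟧))
    ≡⟨ ∑-tabulate n id _ _ slice ⟩
  ∑ (downFrom n) (λ v → ∑ (box d n) (λ z → ⟦ extend (suc d) n A (v ∷ z) ⟧))
    ≡⟨ ∑-tuples d (downFrom n) _ ⟨
  ∑ (box (suc d) n) (λ z → ⟦ extend (suc d) n A z ⟧) ∎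
  where
  open ≡-Reasoning
  slice : ∀ v → ∑ (indices (replicate d n)) (λ is → ⟦ A (v ∷ is) ⟧) ≡
                ∑ (box d n) (λ z → ⟦ extend (suc d) n A (toℕ v ∷ z) ⟧)
  slice v with toℕ v <? n
  ... | yes v<n = trans (∑-cong (indices (replicate d n)) λ is →
      cong (λ u → ⟦ A (u ∷ is) ⟧) (sym (fromℕ<-toℕ v v<n)))
                        (∑-extend d n (λ is → A (fromℕ< v<n ∷ is)))
  ... | no  v≮n = contradiction (toℕ<n v) v≮n

-- Makes an arbitrary tuple direction `ℓ` the scan direction.
ones≡total : ∀ e n (ℓ : Fin (suc e)) (A : Matrix (replicate (suc e) n)) →
  ones A ≡ total (λ y x → extend (suc e) n A (insertAt y ℓ x)) n
ones≡total e n ℓ A = begin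
  ones A
    ≡⟨ length-filterᵇ A (indices (replicate (suc e) n)) ⟩
  ∑ (indices (replicate (suc e) n)) (λ i → ⟦ A i ⟧)
    ≡⟨ ∑-extend (suc e) n A ⟩
  ∑ (box (suc e) n) (λ z → ⟦ extend (suc e) n A z ⟧)
    ≡⟨ ∑-tuples-insertAt e (downFrom n) ℓ _ ⟩
  ∑ (downFrom n) (λ x → ∑ (box e n) (λ y → ⟦ extend (suc e) n A (insertAt y ℓ x) ⟧))
    ≡⟨ ∑-swap (downFrom n) (box e n) _ ⟩
  ∑ (box e n) (λ y → ∑ (downFrom n) (λ x → ⟦ extend (suc e) n A (insertAt y ℓ x) ⟧))
    ≡⟨ ∑-cong (box e n) (λ y → sym (count≡∑ (λ x → extend (suc e) n A (insertAt y ℓ x)) n)) ⟩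
  total (λ y x → extend (suc e) n A (insertAt y ℓ x)) n ∎
  where open ≡-Reasoning

-- Containment from embeddings, and coordinates in a Kronecker product.

coord-ext : {ns : Vec ℕ d} {i i′ : Index ns} → (∀ ℓ → coord i ℓ ≡ coord i′ ℓ) → i ≡ i′
coord-ext {i = []}     {[]}       eq = refl
coord-ext {i = i ∷ is} {i′ ∷ is′} eq = cong₂ _∷_ (eq zero) (coord-ext (eq ∘ suc))

selections : {ms ns : Vec ℕ d} → (∀ ℓ → Selection (lookup ms ℓ) (lookup ns ℓ)) →
    Pointwise Selection ms ns
selections σ = extensional⇒inductive (ext σ)

coord-select : {ms ns : Vec ℕ d} (σ : ∀ ℓ → Selection (lookup ms ℓ) (lookup ns ℓ)) (i : Index ms)
    (ℓ : Fin d) →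
  coord (select {ns = ns} (selections σ) i) ℓ ≡ proj₁ (σ ℓ) (coord i ℓ)
coord-select {ns = n ∷ ns} σ (i ∷ is) zero    = refl
coord-select {ns = n ∷ ns} σ (i ∷ is) (suc ℓ) = coord-select (λ ℓ → σ (suc ℓ)) is ℓ

-- The selection in direction `ℓ` sends `w` to the coordinate of the image of some one of `M` with
-- `ℓ`-th coordinate `w`: `hit` provides that one, and `well` makes the choice immaterial.
embed⇒Contains : {ms ns : Vec ℕ d} (A : Matrix ns) (M : Matrix ms) →
  (point : ∀ m → T (M m) → Index ns) → (∀ m t → T (A (point m t))) →
  (∀ ℓ w → ∃[ m ] (coord m ℓ ≡ w × T (M m))) →
  (∀ {m t m′ t′} ℓ → coord m ℓ ≡ coord m′ ℓ → coord (point m t) ℓ ≡ coord (point m′ t′) ℓ) →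
  (∀ {m t m′ t′} ℓ → coord m ℓ Fin.< coord m′ ℓ → coord (point m t) ℓ Fin.< coord (point m′ t′) ℓ) →
  Contains A M
embed⇒Contains {ms = ms} {ns} A M point inside hit well mono =
  selections σ , λ m t → subst (T ∘ A) (sym (coord-ext λ ℓ →
    trans (coord-select σ m ℓ) (well ℓ (proj₁ (proj₂ (hit ℓ (coord m ℓ))))))) (inside m t)
  where
  σ : ∀ ℓ → Selection (lookup ms ℓ) (lookup ns ℓ)
  σ ℓ = (λ w → coord (point (proj₁ (hit ℓ w)) (proj₂ (proj₂ (hit ℓ w)))) ℓ) ,
        λ {w} {w′} w<w′ → mono ℓ (subst₂ Fin._<_ (sym (proj₁ (proj₂ (hit ℓ w))))
            (sym (proj₁ (proj₂ (hit ℓ w′)))) w<w′)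

withCoord : {ns : Vec ℕ d} → Index ns → (ℓ : Fin d) (w : Fin (lookup ns ℓ)) →
    ∃[ i ] coord {ns = ns} i ℓ ≡ w
withCoord (i ∷ is) zero    w = w ∷ is , refl
withCoord (i ∷ is) (suc ℓ) w with is′ , eq ← withCoord is ℓ w = i ∷ is′ , eq

constant : ∀ d {n} → Fin n → Index (replicate d n)
constant zero    v = []
constant (suc d) v = v ∷ constant d v

toℕ-coord-constant : ∀ d {n} (v : Fin n) ℓ → toℕ (coord (constant d v) ℓ) ≡ toℕ v
toℕ-coord-constant (suc d) v zero    = refl
toℕ-coord-constant (suc d) v (suc ℓ) = toℕ-coord-constant d v ℓ

combines : (ms ns : Vec ℕ d) → Index ms → Index ns → Index (zipWith _*_ ms ns)
combines []       []       []       []       = []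
combines (m ∷ ms) (n ∷ ns) (i ∷ is) (r ∷ rs) = combine i r ∷ combines ms ns is rs

quotients-combines : (ms ns : Vec ℕ d) (i : Index ms) (r : Index ns) →
    quotients ms ns (combines ms ns i r) ≡ i
quotients-combines []       []       []       []       = refl
quotients-combines (m ∷ ms) (n ∷ ns) (i ∷ is) (r ∷ rs) =
  cong₂ _∷_ (cong proj₁ (remQuot-combine i r)) (quotients-combines ms ns is rs)

remainders-combines : (ms ns : Vec ℕ d) (i : Index ms) (r : Index ns) →
    remainders ms ns (combines ms ns i r) ≡ r
remainders-combines []       []       []       []       = refl
remainders-combines (m ∷ ms) (n ∷ ns) (i ∷ is) (r ∷ rs) =
  cong₂ _∷_ (cong proj₂ (remQuot-combine i r)) (remainders-combines ms ns is rs)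

toℕ-coord : (ms ns : Vec ℕ d) (i : Index (zipWith _*_ ms ns)) (ℓ : Fin d) →
  toℕ (coord i ℓ) ≡ lookup ns ℓ * toℕ (coord (quotients ms ns i) ℓ) + toℕ
      (coord (remainders ms ns i) ℓ)
toℕ-coord (m ∷ ms) (n ∷ ns) (i ∷ is) zero    =
  trans (cong toℕ (sym (combine-remQuot {m} n i)))
      (toℕ-combine (quotient {m} n i) (remainder {m} n i))
toℕ-coord (m ∷ ms) (n ∷ ns) (i ∷ is) (suc ℓ) = toℕ-coord ms ns is ℓ

quotient-order : ∀ {n q r q′ r′} → r′ < n → q′ < q → n * q′ + r′ < n * q + r
quotient-order {n} {q} {r} {q′} {r′} r′<n q′<q = begin-strict
  n * q′ + r′    <⟨ +-monoʳ-< (n * q′) r′<n ⟩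
  n * q′ + n     ≡⟨ trans (+-comm (n * q′) n) (sym (*-suc n q′)) ⟩
  n * suc q′     ≤⟨ *-monoʳ-≤ n q′<q ⟩
  n * q          ≤⟨ m≤m+n (n * q) r ⟩
  n * q + r      ∎
  where open ≤-Reasoning

lexicographic-< : ∀ {n q r q′ r′} → r < n → r′ < n → n * q + r < n * q′ + r′ →
    q < q′ ⊎ (q ≡ q′ × r < r′)
lexicographic-< {n} {q} {r} {q′} {r′} r<n r′<n lt with <-cmp q q′
... | tri< q<q′ _ _ = inj₁ q<q′
... | tri≈ _ refl _ = inj₂ (refl , +-cancelˡ-< (n * q) r r′ lt)
... | tri> _ _ q′<q = contradiction lt (<⇒≯ (quotient-order r′<n q′<q))

lexicographic-≡ : ∀ {n q r q′ r′} → r < n → r′ < n → n * q + r ≡ n * q′ + r′ → q ≡ q′ × r ≡ r′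
lexicographic-≡ {n} {q} {r} {q′} {r′} r<n r′<n eq with <-cmp q q′
... | tri< q<q′ _ _ = contradiction eq (<⇒≢ (quotient-order r<n q<q′))
... | tri≈ _ refl _ = refl , +-cancelˡ-≡ (n * q) r r′ eq
... | tri> _ _ q′<q = contradiction (sym eq) (<⇒≢ (quotient-order r′<n q′<q))

tupleIndex : ∀ {j} (ℓ : Fin d) → Fin j → Index (tupleShape j ℓ)
tupleIndex {suc d} zero    r = r ∷ constant d zero
tupleIndex {suc d} (suc ℓ) r = zero ∷ tupleIndex ℓ r

Ones : {ns : Vec ℕ d} → Matrix ns → Set
Ones P = ∃[ i ] T (P i)

-- From relaxed to genuine containment of a tuple matrix.

module Embedding (e k n j : ℕ) (ℓ₀ : Fin (suc e))
  (P : Matrix (replicate (suc e) (suc k))) (perm : IsPermutation P)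
  (A : Matrix (replicate (suc e) n)) where

  ks : Vec ℕ (suc e)
  ks = replicate (suc e) (suc k)

  shape : Vec ℕ (suc e)
  shape = tupleShape (suc j) ℓ₀

  ranks : Ones P → Fin e → ℕ
  ranks (i , _) ℓ = toℕ (coord i (punchIn ℓ₀ ℓ))

  rank : Ones P → ℕ
  rank (i , _) = toℕ (coord i ℓ₀)

  points : Vec ℕ e → ℕ → Bool
  points y x = extend (suc e) n A (insertAt y ℓ₀ x)

  coord< : (i : Index ks) (ℓ : Fin (suc e)) → toℕ (coord i ℓ) < suc k
  coord< i ℓ = <-≤-trans (toℕ<n (coord i ℓ)) (≤-reflexive (lookup-replicate ℓ (suc k)))

  -- A cross section of a permutation matrix has a single one, so any coordinate determines the
  -- point of the pattern, and with it its line and window.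
  one-unique : (i i′ : Ones P) (ℓ : Fin (suc e)) → coord (proj₁ i) ℓ ≡ coord (proj₁ i′) ℓ → i ≡ i′
  one-unique (i , t) (i′ , t′) ℓ eq
    with refl ← trans (sym (proj₂ (proj₂ (perm ℓ (coord i ℓ))) (refl , t)))
        (proj₂ (proj₂ (perm ℓ (coord i ℓ))) (sym eq , t′))
    = cong (i ,_) (T-irrelevant t t′)

  Position : Set
  Position = Index (zipWith _*_ ks shape)

  quot : Position → Index ks
  quot = quotients ks shape

  rem : Position → Index shape
  rem = remainders ks shape

  one : (m : Position) → T (tuple (suc j) ℓ₀ P m) → Ones P
  one m t = quot m , proj₁ (Equivalence.to T-∧ t)

  tuple-< : ∀ m m′ ℓ → coord m ℓ Fin.< coord m′ ℓ →
    toℕ (coord (quot m) ℓ) < toℕ (coord (quot m′) ℓ) ⊎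
    (coord (quot m) ℓ ≡ coord (quot m′) ℓ × toℕ (coord (rem m) ℓ) < toℕ (coord (rem m′) ℓ))
  tuple-< m m′ ℓ lt
    with lexicographic-< (toℕ<n (coord (rem m) ℓ)) (toℕ<n (coord (rem m′) ℓ))
           (subst₂ _<_ (toℕ-coord ks shape m ℓ) (toℕ-coord ks shape m′ ℓ) lt)
  ... | inj₁ q<      = inj₁ q<
  ... | inj₂ (q≡ , r<) = inj₂ (toℕ-injective q≡ , r<)

  tuple-≡ : ∀ m m′ ℓ → coord m ℓ ≡ coord m′ ℓ →
    coord (quot m) ℓ ≡ coord (quot m′) ℓ × toℕ (coord (rem m) ℓ) ≡ toℕ (coord (rem m′) ℓ)
  tuple-≡ m m′ ℓ eq
    with q≡ , r≡ ← lexicographic-≡ (toℕ<n (coord (rem m) ℓ)) (toℕ<n (coord (rem m′) ℓ))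
           (subst₂ _≡_ (toℕ-coord ks shape m ℓ) (toℕ-coord ks shape m′ ℓ) (cong toℕ eq))
    = toℕ-injective q≡ , r≡

  -- Start from any position with the right coordinate, keep its remainders, and replace its
  -- quotients by the one of `P` in the corresponding cross section.
  hit : ∀ ℓ (w : Fin (lookup (zipWith _*_ ks shape) ℓ)) →
      ∃[ m ] (coord m ℓ ≡ w × T (tuple (suc j) ℓ₀ P m))
  hit ℓ w
    with m₀ , m₀≡w ← withCoord {ns = zipWith _*_ ks shape}
        (combines ks shape (constant (suc e) zero) (tupleIndex ℓ₀ zero)) ℓ w
    with i , (i≡ , t) , _ ← perm ℓ (coord (quot m₀) ℓ)
    = m , trans (toℕ-injective same) m₀≡w , Equivalence.from T-∧
        (subst (T ∘ P) (sym (quotients-combines ks shape i (rem m₀))) t , tt)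
    where
    m : Position
    m = combines ks shape i (rem m₀)
    same : toℕ (coord m ℓ) ≡ toℕ (coord m₀ ℓ)
    same = trans (toℕ-coord ks shape m ℓ) (trans
      (cong₂ (λ q r → lookup shape ℓ * toℕ (coord q ℓ) + toℕ (coord r ℓ))
          (quotients-combines ks shape i (rem m₀)) (remainders-combines ks shape i (rem m₀)))
      (trans (cong (λ v → lookup shape ℓ * toℕ v + toℕ (coord (rem m₀) ℓ)) i≡)
          (sym (toℕ-coord ks shape m₀ ℓ))))

  rem< : ∀ m → toℕ (coord (rem m) ℓ₀) < suc j
  rem< m = <-≤-trans (toℕ<n (coord (rem m) ℓ₀))
      (≤-reflexive (lookup∘update ℓ₀ (replicate (suc e) 1) (suc j)))

  rem≡0 : ∀ m {ℓ} → ℓ₀ ≢ ℓ → toℕ (coord (rem m) ℓ) ≡ 0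
  rem≡0 m {ℓ} ℓ₀≢ℓ = n<1⇒n≡0 (<-≤-trans (toℕ<n (coord (rem m) ℓ))
    (≤-reflexive (trans (lookup∘update′ (≢-sym ℓ₀≢ℓ) (replicate (suc e) 1) (suc j))
        (lookup-replicate ℓ 1))))

  module _ (K : Config (suc j) ranks rank points) where
    -- The one with number `r` in the tuple replacing `i` is realised by the one with number `r` in
    -- the window of `i`. Disjoint windows order different tuples, and ranks order the ones of a
    -- single tuple.
    pick : (i : Ones P) (r : ℕ) → r < suc j →
      ∃[ x ] (start K i ≤ x × x < stop K i × T (points (line K i) x) × count
          (points (line K i)) x ≡ r + count (points (line K i)) (start K i))
    pick i r r<j = nth-from (points (line K i)) {r}
        (≤-trans (+-monoˡ-≤ (count (points (line K i)) (start K i)) r<j) (dense K i))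

    pick-< : ∀ {i i′ r r′} r<j r′<j → i ≡ i′ → r < r′ →
        proj₁ (pick i r r<j) < proj₁ (pick i′ r′ r′<j)
    pick-< {i} {r = r} {r′} r<j r′<j refl r<r′ =
      let _ , _ , _ , _ , c = pick i r r<j ; _ , _ , _ , _ , c′ = pick i r′ r′<j in
      count-cancel-< (points (line K i))
          (subst₂ _<_ (sym c) (sym c′) (+-monoˡ-< (count (points (line K i)) (start K i)) r<r′))

    pick-≡ : ∀ {i i′ r r′} r<j r′<j → i ≡ i′ → r ≡ r′ →
        proj₁ (pick i r r<j) ≡ proj₁ (pick i′ r′ r′<j)
    pick-≡ {i} {r = r} r<j r′<j refl refl = cong (proj₁ ∘ pick i r) (≤-irrelevant r<j r′<j)

    x : (m : Position) → T (tuple (suc j) ℓ₀ P m) → ℕ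
    x m t = proj₁ (pick (one m t) (toℕ (coord (rem m) ℓ₀)) (rem< m))

    preimage : ∀ m t → ∃[ a ] (T (A a) × ∀ ℓ →
        toℕ (coord a ℓ) ≡ lookup (insertAt (line K (one m t)) ℓ₀ (x m t)) ℓ)
    preimage m t = extend⇒ (suc e) n A (insertAt (line K (one m t)) ℓ₀ (x m t))
      (proj₁ (proj₂ (proj₂ (proj₂ (pick (one m t) (toℕ (coord (rem m) ℓ₀)) (rem< m))))))

    point : ∀ m → T (tuple (suc j) ℓ₀ P m) → Index (replicate (suc e) n)
    point m t = proj₁ (preimage m t)

    point-ℓ₀ : ∀ m t → toℕ (coord (point m t) ℓ₀) ≡ x m t
    point-ℓ₀ m t = trans (proj₂ (proj₂ (preimage m t)) ℓ₀)
        (insertAt-lookup (line K (one m t)) ℓ₀ (x m t))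

    point-punchIn : ∀ m t ℓ → toℕ (coord (point m t) (punchIn ℓ₀ ℓ)) ≡ lookup (line K (one m t)) ℓ
    point-punchIn m t ℓ = trans (proj₂ (proj₂ (preimage m t)) (punchIn ℓ₀ ℓ))
        (insertAt-punchIn (line K (one m t)) ℓ₀ (x m t) ℓ)

    well-ℕ : ∀ {m t m′ t′} ℓ → coord m ℓ ≡ coord m′ ℓ →
        toℕ (coord (point m t) ℓ) ≡ toℕ (coord (point m′ t′) ℓ)
    well-ℕ {m} {t} {m′} {t′} ℓ eq with q≡ , r≡ ← tuple-≡ m m′ ℓ eq with ℓ₀ Fin.≟ ℓ
    ... | yes refl = trans (point-ℓ₀ m t)
        (trans (pick-≡ (rem< m) (rem< m′) (one-unique (one m t) (one m′ t′) ℓ q≡) r≡)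
        (sym (point-ℓ₀ m′ t′)))
    ... | no ℓ₀≢ℓ  = subst (λ ℓ → toℕ (coord (point m t) ℓ) ≡ toℕ (coord (point m′ t′) ℓ))
        (punchIn-punchOut ℓ₀≢ℓ)
      (trans (point-punchIn m t (punchOut ℓ₀≢ℓ)) (trans
        (cong (λ i → lookup (line K i) (punchOut ℓ₀≢ℓ)) (one-unique (one m t) (one m′ t′) ℓ q≡))
        (sym (point-punchIn m′ t′ (punchOut ℓ₀≢ℓ)))))

    mono : ∀ {m t m′ t′} ℓ → coord m ℓ Fin.< coord m′ ℓ →
        coord (point m t) ℓ Fin.< coord (point m′ t′) ℓ
    mono {m} {t} {m′} {t′} ℓ lt with tuple-< m m′ ℓ lt | ℓ₀ Fin.≟ ℓ
    ... | inj₁ q<        | yes refl = subst₂ _<_ (sym (point-ℓ₀ m t)) (sym (point-ℓ₀ m′ t′))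
      (<-≤-trans (proj₁ (proj₂ (proj₂ (pick (one m t) _ (rem< m)))))
        (≤-trans (stop≤start K {one m t} {one m′ t′} q<)
            (proj₁ (proj₂ (pick (one m′ t′) _ (rem< m′))))))
    ... | inj₂ (q≡ , r<) | yes refl = subst₂ _<_ (sym (point-ℓ₀ m t)) (sym (point-ℓ₀ m′ t′))
      (pick-< (rem< m) (rem< m′) (one-unique (one m t) (one m′ t′) ℓ q≡) r<)
    -- Away from `ℓ₀` the blocks of the product have side 1, so both remainders are 0.
    ... | inj₂ (_ , r<)  | no ℓ₀≢ℓ  = contradiction
        (subst₂ _<_ (rem≡0 m ℓ₀≢ℓ) (rem≡0 m′ ℓ₀≢ℓ) r<) λ ()
    ... | inj₁ q<        | no ℓ₀≢ℓ  = subst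
        (λ ℓ → toℕ (coord (point m t) ℓ) < toℕ (coord (point m′ t′) ℓ)) (punchIn-punchOut ℓ₀≢ℓ)
      (subst₂ _<_ (sym (point-punchIn m t (punchOut ℓ₀≢ℓ)))
          (sym (point-punchIn m′ t′ (punchOut ℓ₀≢ℓ)))
        (line-< K {one m t} {one m′ t′} (punchOut ℓ₀≢ℓ)
          (subst (λ ℓ → toℕ (coord (quot m) ℓ) < toℕ (coord (quot m′) ℓ))
              (sym (punchIn-punchOut ℓ₀≢ℓ)) q<)))

    contains : Contains A (tuple (suc j) ℓ₀ P)
    contains = embed⇒Contains A (tuple (suc j) ℓ₀ P) point
        (λ m t → proj₁ (proj₂ (preimage m t))) hit
      (λ {m} {t} {m′} {t′} ℓ eq → toℕ-injective (well-ℕ {m} {t} {m′} {t′} ℓ eq))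
      (λ {m} {t} {m′} {t′} → mono {m} {t} {m′} {t′})

ones-bounded : ∀ e k j → ∃[ C ] ∀ n ℓ (P : Matrix (replicate (suc e) (suc k))) → IsPermutation P →
  ∀ (A : Matrix (replicate (suc e) n)) → Avoids A (tuple (suc j) ℓ P) → ones A ≤ C * n ^ e
ones-bounded e k j with C , bound ← bounded (suc k) e j = C , λ n ℓ P perm A avoids →
  let open Embedding e k n j ℓ P perm A in
  ≤-trans (≤-reflexive (ones≡total e n ℓ A))
    (bound ranks rank (λ i ℓ′ → coord< (proj₁ i) (punchIn ℓ ℓ′)) (λ i → coord< (proj₁ i) ℓ) points
        (λ K → avoids (contains K)) n)

-- Lower bound: the diagonal permutation and a full cross section.

diagonal? : ∀ e {k} (i : Index (replicate (suc e) k)) →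
    Dec (∀ ℓ → toℕ (coord i ℓ) ≡ toℕ (coord i zero))
diagonal? e i = Fin.all? λ ℓ → toℕ (coord i ℓ) ≟ toℕ (coord i zero)

-- The identity permutation. It shows that `F` maximises over a nonempty set, and it is the pattern
-- behind the lower bound.
diagonal : ∀ e k → Matrix (replicate (suc e) k)
diagonal e k i = ⌊ diagonal? e i ⌋

diagonal-isPermutation : ∀ e k → IsPermutation (diagonal e k)
diagonal-isPermutation e k ℓ v =
  constant (suc e) v′ ,
  (toℕ-injective (trans (toℕ-coord-constant (suc e) v′ ℓ) v′≡v) ,
   fromWitness {a? = diagonal? e (constant (suc e) v′)} (toℕ-coord-constant (suc e) v′)) ,
  λ {i} (i≡v , t) → coord-ext λ ℓ′ → toℕ-injective (trans (toℕ-coord-constant (suc e) v′ ℓ′)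
    (trans v′≡v (trans (cong toℕ (sym i≡v))
        (trans (toWitness {a? = diagonal? e i} t ℓ) (sym (toWitness {a? = diagonal? e i} t ℓ′))))))
  where
  v′ : Fin k
  v′ = fromℕ< (<-≤-trans (toℕ<n v) (≤-reflexive (lookup-replicate ℓ k)))
  v′≡v : toℕ v′ ≡ toℕ v
  v′≡v = toℕ-fromℕ< _

slab : ∀ e n → Matrix (replicate (suc e) n)
slab e n (i ∷ _) = toℕ i ≡ᵇ 0

length-indices : ∀ e n → ∑ (indices (replicate e n)) (λ _ → 1) ≡ n ^ e
length-indices zero    n = refl
length-indices (suc e) n = begin
  ∑ (indices (replicate (suc e) n)) (λ _ → 1)
    ≡⟨ ∑-cartesianProductWith _∷_ (allFin n) (indices (replicate e n)) _ ⟩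
  ∑ (allFin n) (λ _ → ∑ (indices (replicate e n)) (λ _ → 1))
    ≡⟨ ∑-const (allFin n) _ ⟩
  length (allFin n) * ∑ (indices (replicate e n)) (λ _ → 1)
    ≡⟨ cong₂ _*_ (length-tabulate {n = n} id) (length-indices e n) ⟩
  n ^ suc e ∎
  where open ≡-Reasoning

ones-slab : ∀ e n → suc n ^ e ≤ ones (slab e (suc n))
ones-slab e n = begin
  suc n ^ e
    ≡⟨ length-indices e (suc n) ⟨
  ∑ (indices (replicate e (suc n))) (λ _ → 1)
    -- Only the summand with first coordinate 0 is kept.
    ≤⟨ m≤m+n _ _ ⟩
  ∑ (allFin (suc n)) (λ v → ∑ (indices (replicate e (suc n))) (λ is → ⟦ toℕ v ≡ᵇ 0 ⟧))
    ≡⟨ ∑-cartesianProductWith _∷_ (allFin (suc n)) (indices (replicate e (suc n)))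
        (λ i → ⟦ slab e (suc n) i ⟧) ⟨
  ∑ (indices (replicate (suc e) (suc n))) (λ i → ⟦ slab e (suc n) i ⟧)
    ≡⟨ length-filterᵇ (slab e (suc n)) (indices (replicate (suc e) (suc n))) ⟨
  ones (slab e (suc n)) ∎
  where open ≤-Reasoning

-- A tuple of at least two ones, here those with remainders 0 and 1 over one point of `P`, needs two
-- distinct values of the first coordinate; this is where `2 ≤ j` enters.
slab-avoids : ∀ e k n j (P : Matrix (replicate (suc e) (suc k))) → Ones P →
    Avoids (slab e n) (tuple (2 + j) zero P)
slab-avoids e k n j P (v ∷ vs , t) ((σ , σ-mono) ∷ σs , contained) =
  <⇒≢ (σ-mono (first<second)) (trans (at-zero zero) (sym (at-zero (suc zero))))
  where
  ks = replicate e (suc k)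

  position : Fin (2 + j) → Index (zipWith _*_ (suc k ∷ ks) (tupleShape (2 + j) zero))
  position r = combines (suc k ∷ ks) (tupleShape (2 + j) zero) (v ∷ vs) (r ∷ constant e zero)

  at-zero : ∀ r → toℕ (σ (combine v r)) ≡ 0
  at-zero r = ≡ᵇ⇒≡ _ 0 (contained (position r) (Equivalence.from T-∧
    (subst (T ∘ P) (sym (quotients-combines (suc k ∷ ks) (tupleShape (2 + j) zero) (v ∷ vs)
        (r ∷ constant e zero))) t , tt)))

  first<second : combine {n = 2 + j} v zero Fin.< combine v (suc zero)
  first<second = subst₂ _<_ (sym (toℕ-combine v zero)) (sym (toℕ-combine v (suc zero)))
      (+-monoʳ-< ((2 + j) * toℕ v) (n<1+n 0))

-- Supplies the avoiding matrix that `f-isMaximum` asks for.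
zeros-avoid : ∀ n {ms : Vec ℕ d} (M : Matrix ms) → Ones M →
    Avoids {ns = replicate d n} (λ _ → false) M
zeros-avoid n M (i , t) (_ , contained) = contained i t

tuple-Ones : ∀ e k j ℓ (P : Matrix (replicate (suc e) (suc k))) → IsPermutation P →
    Ones (tuple (suc j) ℓ P)
tuple-Ones e k j ℓ P perm with i , (_ , t) , _ ← perm zero zero =
  combines ks (tupleShape (suc j) ℓ) i (tupleIndex ℓ zero) ,
  Equivalence.from T-∧ (subst (T ∘ P)
      (sym (quotients-combines ks (tupleShape (suc j) ℓ) i (tupleIndex ℓ zero))) t , tt)
  where ks = replicate (suc e) (suc k)

-- Bounds for the maxima and conclusion.

module Values (e k j n : ℕ) where

  D : Matrix (replicate (suc e) (suc k))
  D = diagonal e (suc k)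

  F-max : IsMaximum (TupleValue n (2 + j) (suc k) (suc e)) (F n (2 + j) (suc k) (suc e))
  F-max = F-isMaximum n (2 + j) (suc k) (suc e)
      (_ , zero , D , diagonal-isPermutation e (suc k) , refl)

  f-max : ∀ ℓ P → IsPermutation P →
    IsMaximum (NumberOfOnesAvoiding n (tuple (2 + j) ℓ P)) (f n (tuple (2 + j) ℓ P))
  f-max ℓ P perm = f-isMaximum n (tuple (2 + j) ℓ P)
    (_ , (λ _ → false) , zeros-avoid n (tuple (2 + j) ℓ P) (tuple-Ones e k (suc j) ℓ P perm) , refl)

  ones≤F : ∀ ℓ P → IsPermutation P → (A : Matrix (replicate (suc e) n)) →
      Avoids A (tuple (2 + j) ℓ P) →
    ones A ≤ F n (2 + j) (suc k) (suc e)
  ones≤F ℓ P perm A avoids =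
    ≤-trans (proj₂ (f-max ℓ P perm) (ones A) (A , avoids , refl))
            (proj₂ F-max (f n (tuple (2 + j) ℓ P)) (ℓ , P , perm , refl))

  -- Both maxima are attained, so `F` is the number of ones of one particular avoiding matrix.
  F≤ : ∀ w → (∀ ℓ P → IsPermutation P → (A : Matrix (replicate (suc e) n)) →
      Avoids A (tuple (2 + j) ℓ P) → ones A ≤ w) →
    F n (2 + j) (suc k) (suc e) ≤ w
  F≤ w bound =
    let ℓ , P , perm , f≡F   = proj₁ F-max
        A , avoids , ones≡f  = proj₁ (f-max ℓ P perm)
    in subst (_≤ w) (trans ones≡f f≡F) (bound ℓ P perm A avoids)

lower-bound : ∀ e k j n → suc n ^ e ≤ F (suc n) (2 + j) (suc k) (suc e)
lower-bound e k j n = ≤-trans (ones-slab e n)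
  (ones≤F zero D (diagonal-isPermutation e (suc k)) (slab e (suc n))
      (slab-avoids e k (suc n) j D diagonal-one))
  where
  open Values e k j (suc n)
  diagonal-one : Ones D
  diagonal-one = let i , (_ , t) , _ = diagonal-isPermutation e (suc k) zero zero in i , t

upper-bound : ∀ e k j → ∃[ C ] ∀ n → F n (2 + j) (suc k) (suc e) ≤ C * n ^ e
upper-bound e k j =
  let C , bound = ones-bounded e k (suc j) in
  C , λ n → Values.F≤ e k j n (C * n ^ e) (bound n)

sandwich : ∀ (g h : ℕ → ℕ) C → (∀ n → h (suc n) ≤ g (suc n)) → (∀ n → g n ≤ C * h n) → g =Θ h
sandwich g h C lower upper =
  -- `suc C` is positive even when `C` is 0. The threshold is 1 because the lower bound is given at
  -- successors only; in dimension one at size 0 it would read `1 ≤ 0`.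
  1 , suc C , ≤-refl , s≤s z≤n , 1 , λ { zero () ; (suc n) _ →
    ≤-trans (lower n) (≤-reflexive (sym (*-identityˡ (g (suc n))))) ,
    ≤-trans (upper (suc n)) (m≤n+m (C * h (suc n)) (h (suc n))) }

theorem3p1 : (d k : ℕ) → 1 ≤ d → 1 ≤ k → (j : ℕ) → 2 ≤ j →
    (λ n → F n j k d) =Θ (λ n → n ^ (d ∸ 1))
theorem3p1 (suc e) (suc k) _ _ (suc (suc j)) (s≤s (s≤s _)) =
  let C , upper = upper-bound e k j in
  sandwich (λ n → F n (2 + j) (suc k) (suc e)) (_^ e) C (lower-bound e k j) upper
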